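{- There exists a family of Type II self-dual codes $C_i$ over $\mathbb{Z}_4$, with lengths $n_i\to\infty$, such that $\liminf_{i\to\infty} l_i/(2n_i)\ge\delta$, where $l_i$ is the minimal Lee weight of a nonzero codeword of $C_i$ and $\delta\in(0,1/2)$ is the solution of $-\delta\log_2\delta-(1-\delta)\log_2(1-\delta)=\tfrac12$.
   Context: A code over $\mathbb{Z}_4$ is a submodule of $\mathbb{Z}_4^n$, with inner product $\sum x_iy_i \bmod 4$; self-dual means $C=C^\perp$. $\mathrm{Lee}(0)=0,\mathrm{Lee}(1)=\mathrm{Lee}(3)=1,\mathrm{Lee}(2)=2$; the Lee weight of a vector is the sum over coordinates, and its Euclidean norm is $\sum\mathrm{Lee}(u_i)^2$. A self-dual code over $\mathbb{Z}_4$ is Type II if all Euclidean norms of codewords are divisible by 8. -}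

module Defs where

open import Data.Nat using (ℕ; zero; suc; _+_; _*_; _∸_; _^_; _≤_; _<_)
open import Data.Nat.DivMod using (_mod_; _%_)
open import Data.Nat.Divisibility using (_∣_)
open import Data.Fin using (Fin; toℕ)
open import Data.Vec using (Vec; zipWith; map; replicate; foldr)
open import Data.Product using (Σ; _×_; ∃)
open import Relation.Binary.PropositionalEquality using (_≡_)
open import Relation.Nullary using (¬_)
open import Function.Bundles using (_⇔_)

ℤ₄ : Set
ℤ₄ = Fin 4

_+₄_ : ℤ₄ → ℤ₄ → ℤ₄
x +₄ y = (toℕ x + toℕ y) mod 4

_*₄_ : ℤ₄ → ℤ₄ → ℤ₄
x *₄ y = (toℕ x * toℕ y) mod 4

0₄ : ℤ₄
0₄ = Fin.zero

Word : ℕ → Set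
Word n = Vec ℤ₄ n

zeroWord : ∀ n → Word n
zeroWord n = replicate n 0₄

_⊕_ : ∀ {n} → Word n → Word n → Word n
_⊕_ = zipWith _+₄_

_·_ : ∀ {n} → ℤ₄ → Word n → Word n
k · x = map (k *₄_) x

inner : ∀ {n} → Word n → Word n → ℕ
inner x y = foldr (λ _ → ℕ) _+_ 0 (zipWith (λ a b → toℕ a * toℕ b) x y)

Orthogonal : ∀ {n} → Word n → Word n → Set
Orthogonal x y = inner x y % 4 ≡ 0

Code : ℕ → Set₁
Code n = Word n → Set

IsSubmodule : ∀ {n} → Code n → Set
IsSubmodule {n} C =
  C (zeroWord n)
  × (∀ x y → C x → C y → C (x ⊕ y))
  × (∀ k x → C x → C (k · x))

IsSelfDual : ∀ {n} → Code n → Set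
IsSelfDual {n} C = IsSubmodule C × (∀ (x : Word n) → C x ⇔ (∀ y → C y → Orthogonal x y))

lee : ℤ₄ → ℕ
lee Fin.zero = 0
lee (Fin.suc Fin.zero) = 1
lee (Fin.suc (Fin.suc Fin.zero)) = 2
lee (Fin.suc (Fin.suc (Fin.suc Fin.zero))) = 1

leeWeight : ∀ {n} → Word n → ℕ
leeWeight x = foldr (λ _ → ℕ) _+_ 0 (map lee x)

euclidNorm : ∀ {n} → Word n → ℕ
euclidNorm x = foldr (λ _ → ℕ) _+_ 0 (map (λ a → lee a * lee a) x)

IsTypeII : ∀ {n} → Code n → Set
IsTypeII C = IsSelfDual C × (∀ x → C x → 8 ∣ euclidNorm x)

IsMinLee : ∀ {n} → Code n → ℕ → Set
IsMinLee {n} C l =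
  (Σ (Word n) λ x → C x × ¬ (x ≡ zeroWord n) × leeWeight x ≡ l)
  × (∀ x → C x → ¬ (x ≡ zeroWord n) → l ≤ leeWeight x)

-- δ ∈ (0,1/2) is the root of H(δ) = 1/2, H binary entropy.  Since there are
-- no reals, δ is given by its (lower) Dedekind cut: for b > 0, the rational
-- a/b lies strictly below δ iff  a/b < 1/2  and  H(a/b) < 1/2  (H is strictly
-- increasing on [0,1/2]).  Clearing logarithms, H(a/b) < 1/2 is
--   b^(2b) < 2^b · a^(2a) · (b-a)^(2(b-a))   (with 0^0 = 1, i.e. H(0)=0).
BelowDelta : ℕ → ℕ → Set
BelowDelta a b =
  2 * a < b × b ^ (2 * b) < 2 ^ b * (a ^ (2 * a) * (b ∸ a) ^ (2 * (b ∸ a)))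

{-# OPTIONS --safe #-}
module Submission where

-- Write a word of length 2p, 4 ∣ p, as (a , b) and put y = Hb, x = a - y, where H is
-- block diagonal with HᵀH = 7 ≡ -1 (mod 8).  In these coordinates the inner product is
-- x·x′ + x·y′ + x′·y (mod 8).  Let K + Kᵀ = J - I with J the all-ones matrix.  Then
-- x·x + 2 x·Kx = (Σ x)², so {Σ x = 0, y = Kx + t·1} is a self-dual code of Type II.
-- For random K, a given word with some xₖ odd lies in the code with probability at most
-- 16·4⁻ᵖ.  If x is even but nonzero the probability is at most 16·2⁻ᵖ, and a codeword of
-- this kind has all entries even or all entries odd.  Words with all entries odd have
-- Lee weight at least n = 2p, as do the nonzero codewords with x = 0.
-- The Lee enumerators of all words and of the even words are (1 + z)²ⁿ and (1 + z²)ⁿ, so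
-- by Chernoff's bound the balls of radius 2nλ contain at most 2^(2nH(λ)) and 2^(nH(λ))
-- words; for H(λ) < 1/2 both union bounds therefore succeed when n is large.  Choosing K
-- to maximise the minimum Lee weight makes the family independent of λ.

open import Defs
open import Data.Nat as ℕ using (ℕ; zero; suc)
import Data.Nat.Properties as ℕ
open import Data.Fin as Fin using (Fin; zero; suc; toℕ; fromℕ<; splitAt; _↑ˡ_; _↑ʳ_)
import Data.Fin.Properties as Fin
open import Data.Fin.Properties using (all?; any?)
open import Data.Fin.Patterns using (0F; 1F; 2F; 3F)
open import Data.Product using (Σ; ∃; _×_; _,_; proj₁; proj₂)
open import Data.Sum as Sum using (_⊎_; inj₁; inj₂; fromInj₂)
open import Data.Vec using (Vec; []; _∷_; lookup; tabulate; replicate; foldr; map; _++_; _[_]≔_)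
open import Data.Vec.Properties using (lookup-++ˡ; lookup-++ʳ; lookup∘tabulate; lookup-zipWith; lookup-map; lookup-replicate; lookup∘updateAt; lookup∘updateAt′; ≡-dec)
open import Data.List as List using (List; []; _∷_; length; cartesianProductWith; allFin; filter)
import Data.List.Properties as List
open import Data.List.Extrema.Nat using (argmin; argmax; argmin-all; f[argmin]≤f[xs]; f[xs]≤f[argmax])
open import Data.List.Membership.Propositional using (_∈_)
open import Data.List.Membership.Propositional.Properties using (∈-allFin; ∈-filter⁺; ∈-cartesianProductWith⁺)
import Data.List.Relation.Unary.All as All
open import Data.List.Relation.Unary.All.Properties using (all-filter)
open import Data.List.Relation.Unary.Any using (here; there)
open import Data.Nat.Tactic.RingSolver using () renaming (solve-∀ to solve-∀ℕ)
open import Function using (_∘_)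
open import Function.Bundles using (_⇔_; mk⇔; Equivalence)
open import Relation.Nullary using (Dec; yes; no; ¬_; ¬?; contradiction)
open import Relation.Nullary.Decidable using (map′; _×-dec_; _⊎-dec_; _→-dec_; from-yes; decidable-stable)
open import Relation.Binary.PropositionalEquality hiding ([_])

module GraphCodes where

  open import Data.Integer hiding (suc)
  open import Data.Integer.Properties
  open import Data.Integer.Divisibility.Signed
  open import Data.Integer.Tactic.RingSolver using (solve-∀)
  open import Data.Integer.DivMod using (a≡a%ℕn+[a/ℕn]*n; n%ℕd<d)
  import Data.Nat.DivMod as ℕ
  import Data.Nat.Divisibility as ℕ
  open _∣_ using (quotient)
  open import Algebra.Properties.Semiring.Sum +-*-semiring public

  -- Congruences of integers and the inner product of integer vectors.

  infix 4 _≋_[_]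
  -- A record rather than a synonym for `m ∣ a - b`, so that unification can read off `a`, `b` and
  -- `m` from the type.
  record _≋_[_] (a b m : ℤ) : Set where
    constructor mod
    field m∣a-b : m ∣ a - b
  open _≋_[_] public

  ≋-reflexive : ∀ {m a b} → a ≡ b → a ≋ b [ m ]
  ≋-reflexive {m} {a} refl = mod (divides 0ℤ (trans (+-inverseʳ a) (sym (*-zeroˡ m))))

  ≋-sym : ∀ {m a b} → a ≋ b [ m ] → b ≋ a [ m ]
  ≋-sym {m} {a} {b} (mod p) = mod (subst (m ∣_) (lemma a b) (∣m⇒∣-m p))
    where lemma : ∀ a b → - (a - b) ≡ b - a
          lemma = solve-∀

  ≋-trans : ∀ {m a b c} → a ≋ b [ m ] → b ≋ c [ m ] → a ≋ c [ m ]
  ≋-trans {m} {a} {b} {c} (mod p) (mod q) = mod (subst (m ∣_) (lemma a b c) (∣m∣n⇒∣m+n p q))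
    where lemma : ∀ a b c → (a - b) + (b - c) ≡ a - c
          lemma = solve-∀

  ≋-+ : ∀ {m a b c d} → a ≋ b [ m ] → c ≋ d [ m ] → a + c ≋ b + d [ m ]
  ≋-+ {m} {a} {b} {c} {d} (mod p) (mod q) = mod (subst (m ∣_) (lemma a b c d) (∣m∣n⇒∣m+n p q))
    where lemma : ∀ a b c d → (a - b) + (c - d) ≡ (a + c) - (b + d)
          lemma = solve-∀

  ≋-- : ∀ {m a b c d} → a ≋ b [ m ] → c ≋ d [ m ] → a - c ≋ b - d [ m ]
  ≋-- {m} {a} {b} {c} {d} (mod p) (mod q) = mod (subst (m ∣_) (lemma a b c d) (∣m∣n⇒∣m-n p q))
    where lemma : ∀ a b c d → (a - b) - (c - d) ≡ (a - c) - (b - d)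
          lemma = solve-∀

  ≋-* : ∀ {m a b} c → a ≋ b [ m ] → c * a ≋ c * b [ m ]
  ≋-* {m} {a} {b} c (mod p) = mod (subst (m ∣_) (lemma a b c) (∣n⇒∣m*n c p))
    where lemma : ∀ a b c → c * (a - b) ≡ c * a - c * b
          lemma = solve-∀

  ≋-sum : ∀ {m n} {f g : Fin n → ℤ} → (∀ i → f i ≋ g i [ m ]) → sum f ≋ sum g [ m ]
  ≋-sum {n = zero}  p = ≋-reflexive refl
  ≋-sum {n = suc n} p = ≋-+ (p zero) (≋-sum (λ i → p (suc i)))

  ≋⇒∣ : ∀ {m a b} → a ≋ b [ m ] → m ∣ b → m ∣ a
  ≋⇒∣ {m} {a} {b} (mod p) q = subst (m ∣_) (lemma a b) (∣m∣n⇒∣m+n p q)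
    where lemma : ∀ a b → (a - b) + b ≡ a
          lemma = solve-∀

  infixl 7 _∙_
  _∙_ : ∀ {n} → (Fin n → ℤ) → (Fin n → ℤ) → ℤ
  x ∙ y = sum (λ i → x i * y i)

  ∙-comm : ∀ {n} (x y : Fin n → ℤ) → x ∙ y ≡ y ∙ x
  ∙-comm x y = sum-cong-≗ (λ i → *-comm (x i) (y i))

  ∙-≋ : ∀ {m n} (x : Fin n → ℤ) {y z : Fin n → ℤ} → (∀ i → y i ≋ z i [ m ]) → x ∙ y ≋ x ∙ z [ m ]
  ∙-≋ x p = ≋-sum (λ i → ≋-* (x i) (p i))

  ∙-+ʳ : ∀ {n} (x y z : Fin n → ℤ) → x ∙ (λ i → y i + z i) ≡ x ∙ y + x ∙ z
  ∙-+ʳ x y z = trans (sum-cong-≗ (λ i → *-distribˡ-+ (x i) (y i) (z i))) (∑-distrib-+ (λ i → x i * y i) (λ i → x i * z i))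

  ∙-const : ∀ {n} (x : Fin n → ℤ) c → x ∙ (λ _ → c) ≡ c * sum x
  ∙-const x c = trans (sym (*-distribʳ-sum c x)) (*-comm (sum x) c)

  -- The block matrix H and its transpose.

  H : ∀ k → (Fin (k ℕ.* 4) → ℤ) → Fin (k ℕ.* 4) → ℤ
  H (suc k) f 0F = + 2 * f 0F + f 1F + f 2F + f 3F
  H (suc k) f 1F = f 0F - + 2 * f 1F + f 2F - f 3F
  H (suc k) f 2F = f 0F - f 1F - + 2 * f 2F + f 3F
  H (suc k) f 3F = f 0F + f 1F - f 2F - + 2 * f 3F
  H (suc k) f (suc (suc (suc (suc i)))) = H k (λ j → f (4 ↑ʳ j)) i

  Hᵀ : ∀ k → (Fin (k ℕ.* 4) → ℤ) → Fin (k ℕ.* 4) → ℤ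
  Hᵀ (suc k) f 0F = + 2 * f 0F + f 1F + f 2F + f 3F
  Hᵀ (suc k) f 1F = f 0F - + 2 * f 1F - f 2F + f 3F
  Hᵀ (suc k) f 2F = f 0F + f 1F - + 2 * f 2F - f 3F
  Hᵀ (suc k) f 3F = f 0F - f 1F + f 2F - + 2 * f 3F
  Hᵀ (suc k) f (suc (suc (suc (suc i)))) = Hᵀ k (λ j → f (4 ↑ʳ j)) i

  -- This rests on 7 = 2² + 1² + 1² + 1²: up to the signs of its last three rows, each 4×4 block is
  -- right multiplication by the quaternion 2 - i - j - k of norm 7.
  H-∙ : ∀ k (f g : Fin (k ℕ.* 4) → ℤ) → H k f ∙ H k g ≡ + 7 * (f ∙ g)
  H-∙ zero    f g = refl
  H-∙ (suc k) f g = trans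
    (cong (λ s → h f 0F * h g 0F + (h f 1F * h g 1F + (h f 2F * h g 2F + (h f 3F * h g 3F + s))))
          (H-∙ k (λ j → f (4 ↑ʳ j)) (λ j → g (4 ↑ʳ j))))
    (lemma (f 0F) (f 1F) (f 2F) (f 3F) (g 0F) (g 1F) (g 2F) (g 3F) _)
    where
    h = H (suc k)
    lemma : ∀ a b c d a′ b′ c′ d′ s →
      (+ 2 * a + b + c + d) * (+ 2 * a′ + b′ + c′ + d′) +
      ((a - + 2 * b + c - d) * (a′ - + 2 * b′ + c′ - d′) +
      ((a - b - + 2 * c + d) * (a′ - b′ - + 2 * c′ + d′) +
      ((a + b - c - + 2 * d) * (a′ + b′ - c′ - + 2 * d′) + + 7 * s))) ≡
      + 7 * (a * a′ + (b * b′ + (c * c′ + (d * d′ + s))))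
    lemma = solve-∀

  H-Hᵀ : ∀ k f i → H k (Hᵀ k f) i ≡ + 7 * f i
  H-Hᵀ (suc k) f 0F = lemma (f 0F) (f 1F) (f 2F) (f 3F)
    where lemma : ∀ a b c d → + 2 * (+ 2 * a + b + c + d) + (a - + 2 * b - c + d) + (a + b - + 2 * c - d) + (a - b + c - + 2 * d) ≡ + 7 * a
          lemma = solve-∀
  H-Hᵀ (suc k) f 1F = lemma (f 0F) (f 1F) (f 2F) (f 3F)
    where lemma : ∀ a b c d → (+ 2 * a + b + c + d) - + 2 * (a - + 2 * b - c + d) + (a + b - + 2 * c - d) - (a - b + c - + 2 * d) ≡ + 7 * b
          lemma = solve-∀
  H-Hᵀ (suc k) f 2F = lemma (f 0F) (f 1F) (f 2F) (f 3F)
    where lemma : ∀ a b c d → (+ 2 * a + b + c + d) - (a - + 2 * b - c + d) - + 2 * (a + b - + 2 * c - d) + (a - b + c - + 2 * d) ≡ + 7 * c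
          lemma = solve-∀
  H-Hᵀ (suc k) f 3F = lemma (f 0F) (f 1F) (f 2F) (f 3F)
    where lemma : ∀ a b c d → (+ 2 * a + b + c + d) + (a - + 2 * b - c + d) - (a + b - + 2 * c - d) - + 2 * (a - b + c - + 2 * d) ≡ + 7 * d
          lemma = solve-∀
  H-Hᵀ (suc k) f (suc (suc (suc (suc i)))) = H-Hᵀ k (λ j → f (4 ↑ʳ j)) i

  Hᵀ-H : ∀ k f i → Hᵀ k (H k f) i ≡ + 7 * f i
  Hᵀ-H (suc k) f 0F = lemma (f 0F) (f 1F) (f 2F) (f 3F)
    where lemma : ∀ a b c d → + 2 * (+ 2 * a + b + c + d) + (a - + 2 * b + c - d) + (a - b - + 2 * c + d) + (a + b - c - + 2 * d) ≡ + 7 * a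
          lemma = solve-∀
  Hᵀ-H (suc k) f 1F = lemma (f 0F) (f 1F) (f 2F) (f 3F)
    where lemma : ∀ a b c d → (+ 2 * a + b + c + d) - + 2 * (a - + 2 * b + c - d) - (a - b - + 2 * c + d) + (a + b - c - + 2 * d) ≡ + 7 * b
          lemma = solve-∀
  Hᵀ-H (suc k) f 2F = lemma (f 0F) (f 1F) (f 2F) (f 3F)
    where lemma : ∀ a b c d → (+ 2 * a + b + c + d) + (a - + 2 * b + c - d) - + 2 * (a - b - + 2 * c + d) - (a + b - c - + 2 * d) ≡ + 7 * c
          lemma = solve-∀
  Hᵀ-H (suc k) f 3F = lemma (f 0F) (f 1F) (f 2F) (f 3F)
    where lemma : ∀ a b c d → (+ 2 * a + b + c + d) - (a - + 2 * b + c - d) + (a - b - + 2 * c + d) - + 2 * (a + b - c - + 2 * d) ≡ + 7 * d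
          lemma = solve-∀
  Hᵀ-H (suc k) f (suc (suc (suc (suc i)))) = Hᵀ-H k (λ j → f (4 ↑ʳ j)) i

  H-≋ : ∀ {m} k {f g : Fin (k ℕ.* 4) → ℤ} → (∀ i → f i ≋ g i [ m ]) → ∀ i → H k f i ≋ H k g i [ m ]
  H-≋ (suc k) p 0F = ≋-+ (≋-+ (≋-+ (≋-* (+ 2) (p 0F)) (p 1F)) (p 2F)) (p 3F)
  H-≋ (suc k) p 1F = ≋-- (≋-+ (≋-- (p 0F) (≋-* (+ 2) (p 1F))) (p 2F)) (p 3F)
  H-≋ (suc k) p 2F = ≋-+ (≋-- (≋-- (p 0F) (p 1F)) (≋-* (+ 2) (p 2F))) (p 3F)
  H-≋ (suc k) p 3F = ≋-- (≋-- (≋-+ (p 0F) (p 1F)) (p 2F)) (≋-* (+ 2) (p 3F))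
  H-≋ (suc k) p (suc (suc (suc (suc i)))) = H-≋ k (λ j → p (4 ↑ʳ j)) i

  -- The row sums of a block of Hᵀ are 5, -1, -1, -1. All are ±1 modulo 4, which is how codewords
  -- with constant y come to have entries ±t.
  Hᵀ-const : ∀ {m} k {f : Fin (k ℕ.* 4) → ℤ} t → (∀ i → f i ≋ t [ m ]) →
             ∀ i → (Hᵀ k f i ≋ + 5 * t [ m ]) ⊎ (Hᵀ k f i ≋ - t [ m ])
  Hᵀ-const (suc k) t p 0F = inj₁ (≋-trans (≋-+ (≋-+ (≋-+ (≋-* (+ 2) (p 0F)) (p 1F)) (p 2F)) (p 3F)) (≋-reflexive (lemma t)))
    where lemma : ∀ t → + 2 * t + t + t + t ≡ + 5 * t
          lemma = solve-∀
  Hᵀ-const (suc k) t p 1F = inj₂ (≋-trans (≋-+ (≋-- (≋-- (p 0F) (≋-* (+ 2) (p 1F))) (p 2F)) (p 3F)) (≋-reflexive (lemma t)))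
    where lemma : ∀ t → t - + 2 * t - t + t ≡ - t
          lemma = solve-∀
  Hᵀ-const (suc k) t p 2F = inj₂ (≋-trans (≋-- (≋-- (≋-+ (p 0F) (p 1F)) (≋-* (+ 2) (p 2F))) (p 3F)) (≋-reflexive (lemma t)))
    where lemma : ∀ t → t + t - + 2 * t - t ≡ - t
          lemma = solve-∀
  Hᵀ-const (suc k) t p 3F = inj₂ (≋-trans (≋-- (≋-+ (≋-- (p 0F) (p 1F)) (p 2F)) (≋-* (+ 2) (p 3F))) (≋-reflexive (lemma t)))
    where lemma : ∀ t → t - t + t - + 2 * t ≡ - t
          lemma = solve-∀
  Hᵀ-const (suc k) t p (suc (suc (suc (suc i)))) = Hᵀ-const k t (λ j → p (4 ↑ʳ j)) i

  -- Words over Z4 as integer vectors.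

  residue : ℤ → ℤ₄
  residue z = fromℕ< (n%ℕd<d z 4)

  residue-≋ : ∀ z → + toℕ (residue z) ≋ z [ + 4 ]
  residue-≋ z = ≋-sym (mod (divides (z /ℕ 4) (trans (cong₂ _-_ (a≡a%ℕn+[a/ℕn]*n z 4) (cong +_ (Fin.toℕ-fromℕ< (n%ℕd<d z 4))))
    (lemma (+ (z %ℕ 4)) (z /ℕ 4)))))
    where lemma : ∀ r q → r + q * + 4 - r ≡ q * + 4
          lemma = solve-∀

  %4-≋ : ∀ n → + toℕ (n ℕ.mod 4) ≋ + n [ + 4 ]
  %4-≋ n = ≋-sym (mod (divides (+ (n ℕ./ 4)) (trans (cong₂ _-_ (trans (cong +_ (ℕ.m≡m%n+[m/n]*n n 4))
      (trans (pos-+ (n ℕ.% 4) (n ℕ./ 4 ℕ.* 4)) (cong (_+_ (+ (n ℕ.% 4))) (pos-* (n ℕ./ 4) 4))))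
      (cong +_ (Fin.toℕ-fromℕ< (ℕ.m%n<n n 4))))
    (lemma (+ (n ℕ.% 4)) (+ (n ℕ./ 4))))))
    where lemma : ∀ r q → r + q * + 4 - r ≡ q * + 4
          lemma = solve-∀

  sum-++ : ∀ m {n} (f : Fin (m ℕ.+ n) → ℤ) → sum f ≡ sum (λ i → f (i ↑ˡ n)) + sum (λ i → f (m ↑ʳ i))
  sum-++ zero    f = sym (+-identityˡ _)
  sum-++ (suc m) f = trans (cong (_+_ (f 0F)) (sum-++ m (f ∘ suc))) (sym (+-assoc (f 0F) _ _))

  coord : ∀ {n} → Word n → Fin n → ℤ
  coord w i = + toℕ (lookup w i)

  inner-coord : ∀ {n} (v w : Word n) → + inner v w ≡ coord v ∙ coord w
  inner-coord []      []      = refl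
  inner-coord (a ∷ v) (b ∷ w) = trans (pos-+ (toℕ a ℕ.* toℕ b) (inner v w))
    (cong₂ _+_ (pos-* (toℕ a) (toℕ b)) (inner-coord v w))

  ∣inner⇒Orthogonal : ∀ {n} (v w : Word n) → + 4 ∣ coord v ∙ coord w → Orthogonal v w
  ∣inner⇒Orthogonal v w p =
    ℕ.n∣m⇒m%n≡0 (inner v w) 4 (∣⇒∣ᵤ (subst (+ 4 ∣_) (sym (inner-coord v w)) p))

  Orthogonal⇒∣inner : ∀ {n} (v w : Word n) → Orthogonal v w → + 4 ∣ coord v ∙ coord w
  Orthogonal⇒∣inner v w p =
    subst (+ 4 ∣_) (inner-coord v w) (∣ᵤ⇒∣ {+ 4} {+ inner v w} (ℕ.m%n≡0⇒n∣m (inner v w) 4 p))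

  -- Only the letter 3 has a Lee weight different from its representative, and 9 ≡ 1 (mod 8).
  euclidNorm-coord : ∀ {n} (w : Word n) → + euclidNorm w ≋ coord w ∙ coord w [ + 8 ]
  euclidNorm-coord []      = ≋-reflexive refl
  euclidNorm-coord (a ∷ w) = ≋-trans (≋-reflexive (pos-+ (lee a ℕ.* lee a) (euclidNorm w))) (≋-+ (square a) (euclidNorm-coord w))
    where
    square : ∀ a → + (lee a ℕ.* lee a) ≋ + toℕ a * + toℕ a [ + 8 ]
    square 0F = ≋-reflexive refl
    square 1F = ≋-reflexive refl
    square 2F = ≋-reflexive refl
    square 3F = mod (divides (- + 1) refl)

  -- An orthogonal complement is always a submodule, and `C` is its own complement.
  selfDual⇒submodule : ∀ {n} (C : Code n) → (∀ x → C x ⇔ (∀ y → C y → Orthogonal x y)) → IsSubmodule C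
  selfDual⇒submodule {n} C dual =
      Equivalence.from (dual _) (λ y _ → ∣inner⇒Orthogonal (zeroWord n) y
        (subst (+ 4 ∣_) (sym (zero-∙ y)) (divides 0ℤ refl)))
    , (λ v w cv cw → Equivalence.from (dual _) (λ y cy → ∣inner⇒Orthogonal (v ⊕ w) y
        (≋⇒∣ (⊕-∙ v w y) (∣m∣n⇒∣m+n (perp v cv y cy) (perp w cw y cy)))))
    , (λ c v cv → Equivalence.from (dual _) (λ y cy → ∣inner⇒Orthogonal (c · v) y
        (≋⇒∣ (·-∙ c v y) (∣n⇒∣m*n (+ toℕ c) (perp v cv y cy)))))
    where
    perp : ∀ v → C v → ∀ y → C y → + 4 ∣ coord v ∙ coord y
    perp v cv y cy = Orthogonal⇒∣inner v y (Equivalence.to (dual v) cv y cy)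
    zero-∙ : ∀ y → coord (zeroWord n) ∙ coord y ≡ 0ℤ
    zero-∙ y = trans (sum-cong-≗ (λ i → trans (cong (λ a → + toℕ a * coord y i) (lookup-replicate i 0₄)) (*-zeroˡ (coord y i))))
      (sum-replicate-zero n)
    ⊕-∙ : ∀ v w y → coord (v ⊕ w) ∙ coord y ≋ coord v ∙ coord y + coord w ∙ coord y [ + 4 ]
    ⊕-∙ v w y = ≋-trans (≋-reflexive (∙-comm (coord (v ⊕ w)) (coord y)))
      (≋-trans (∙-≋ (coord y) {z = λ i → coord v i + coord w i}
         (λ i → subst (λ a → + toℕ a ≋ coord v i + coord w i [ + 4 ]) (sym (lookup-zipWith _+₄_ i v w))
           (≋-trans (%4-≋ (toℕ (lookup v i) ℕ.+ toℕ (lookup w i))) (≋-reflexive (pos-+ (toℕ (lookup v i)) _)))))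
         (≋-reflexive (trans (∙-+ʳ (coord y) (coord v) (coord w))
           (cong₂ _+_ (∙-comm (coord y) (coord v)) (∙-comm (coord y) (coord w))))))
    ·-∙ : ∀ c v y → coord (c · v) ∙ coord y ≋ + toℕ c * (coord v ∙ coord y) [ + 4 ]
    ·-∙ c v y = ≋-trans (≋-reflexive (∙-comm (coord (c · v)) (coord y)))
      (≋-trans (∙-≋ (coord y) {z = λ i → + toℕ c * coord v i}
         (λ i → subst (λ a → + toℕ a ≋ + toℕ c * coord v i [ + 4 ]) (sym (lookup-map i (c *₄_) v))
           (≋-trans (%4-≋ (toℕ c ℕ.* toℕ (lookup v i))) (≋-reflexive (pos-* (toℕ c) _)))))
         (≋-reflexive (trans (sum-cong-≗ (λ i → lemma (coord y i) (+ toℕ c) (coord v i)))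
           (sym (*-distribˡ-sum (+ toℕ c) (λ i → coord v i * coord y i))))))
      where lemma : ∀ a b c → a * (b * c) ≡ b * (c * a)
            lemma = solve-∀

  -- Integer matrices K with K + Kᵀ = J - I.

  δ : ∀ {n} → Fin n → Fin n → ℤ
  δ zero    zero    = 1ℤ
  δ zero    (suc j) = 0ℤ
  δ (suc i) zero    = 0ℤ
  δ (suc i) (suc j) = δ i j

  δ-∙ : ∀ {n} i (x : Fin n → ℤ) → δ i ∙ x ≡ x i
  δ-∙ {suc n} zero    x = trans (cong₂ _+_ (*-identityˡ (x zero)) (trans (sum-cong-≗ (λ j → *-zeroˡ (x (suc j)))) (sum-replicate-zero n)))
    (+-identityʳ (x zero))
  δ-∙ (suc i) x = trans (cong₂ _+_ (*-zeroˡ (x zero)) (δ-∙ i (x ∘ suc))) (+-identityˡ (x (suc i)))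

  Matrix : ℕ → Set
  Matrix n = Fin n → Fin n → ℤ

  infixl 8 _⊛_
  _⊛_ : ∀ {n} → Matrix n → (Fin n → ℤ) → Fin n → ℤ
  (K ⊛ x) i = K i ∙ x

  ⊛-≋ : ∀ {m n} (K : Matrix n) {x y : Fin n → ℤ} → (∀ i → x i ≋ y i [ m ]) → ∀ i → (K ⊛ x) i ≋ (K ⊛ y) i [ m ]
  ⊛-≋ K p i = ∙-≋ (K i) p

  -- K + Kᵀ = J - I, with J the all-ones matrix
  SkewToOnes : ∀ {n} → Matrix n → Set
  SkewToOnes K = ∀ i j → δ i j + K i j + K j i ≡ 1ℤ

  module _ {n} (K : Matrix n) (skew : SkewToOnes K) where

    transpose-∙ : ∀ x z → x ∙ (λ i → sum (λ j → K j i * z j)) ≡ z ∙ (K ⊛ x)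
    transpose-∙ x z = begin
      sum (λ i → x i * sum (λ j → K j i * z j))
        ≡⟨ sum-cong-≗ (λ i → *-distribˡ-sum (x i) (λ j → K j i * z j)) ⟩
      sum (λ i → sum (λ j → x i * (K j i * z j)))   ≡⟨ ∑-comm (λ i j → x i * (K j i * z j)) ⟩
      sum (λ j → sum (λ i → x i * (K j i * z j)))
        ≡⟨ sum-cong-≗ (λ j → sum-cong-≗ (λ i → lemma (x i) (K j i) (z j))) ⟩
      sum (λ j → sum (λ i → z j * (K j i * x i)))
        ≡⟨ sum-cong-≗ (λ j → sym (*-distribˡ-sum (z j) (λ i → K j i * x i))) ⟩
      z ∙ (K ⊛ x)                                   ∎
      where
      open ≡-Reasoning
      lemma : ∀ a b c → a * (b * c) ≡ c * (b * a)
      lemma = solve-∀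

    -- The left side is the bilinear form of I + K + Kᵀ = J, a matrix of rank one.
    polarisation : ∀ x z → x ∙ z + x ∙ (K ⊛ z) + z ∙ (K ⊛ x) ≡ sum x * sum z
    polarisation x z = begin
      x ∙ z + x ∙ (K ⊛ z) + z ∙ (K ⊛ x)
        ≡⟨ cong₂ _+_ (trans (cong (_+ x ∙ (K ⊛ z)) (sum-cong-≗ (λ i → cong (x i *_) (sym (δ-∙ i z)))))
             (sym (∙-+ʳ x (λ i → δ i ∙ z) (K ⊛ z)))) (sym (transpose-∙ x z)) ⟩
      x ∙ (λ i → δ i ∙ z + K i ∙ z) + x ∙ (λ i → sum (λ j → K j i * z j))
        ≡⟨ sym (∙-+ʳ x (λ i → δ i ∙ z + K i ∙ z) (λ i → sum (λ j → K j i * z j))) ⟩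
      x ∙ (λ i → δ i ∙ z + K i ∙ z + sum (λ j → K j i * z j))
        ≡⟨ sum-cong-≗ (λ i → cong (x i *_) (row i)) ⟩
      x ∙ (λ _ → sum z)
        ≡⟨ trans (∙-const x (sum z)) (*-comm (sum z) (sum x)) ⟩
      sum x * sum z ∎
      where
      open ≡-Reasoning
      row : ∀ i → δ i ∙ z + K i ∙ z + sum (λ j → K j i * z j) ≡ sum z
      row i = begin
        δ i ∙ z + K i ∙ z + sum (λ j → K j i * z j)
          ≡⟨ cong (_+ sum (λ j → K j i * z j)) (sym (∑-distrib-+ (λ j → δ i j * z j) (λ j → K i j * z j))) ⟩
        sum (λ j → δ i j * z j + K i j * z j) + sum (λ j → K j i * z j)
          ≡⟨ sym (∑-distrib-+ (λ j → δ i j * z j + K i j * z j) (λ j → K j i * z j)) ⟩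
        sum (λ j → δ i j * z j + K i j * z j + K j i * z j)
          ≡⟨ sum-cong-≗ (λ j → trans (lemma (δ i j) (K i j) (K j i) (z j)) (trans (cong (_* z j) (skew i j)) (*-identityˡ (z j)))) ⟩
        sum z ∎
        where lemma : ∀ a b c d → a * d + b * d + c * d ≡ (a + b + c) * d
              lemma = solve-∀

  -- Working over an arbitrary p, rather than 4k, keeps sums over Fin p from unfolding.
  record Similarity (p : ℕ) : Set where
    field
      o        : Fin p
      U Uᵀ     : (Fin p → ℤ) → Fin p → ℤ
      U-∙      : ∀ f g → U f ∙ U g ≡ + 7 * (f ∙ g)
      U-Uᵀ     : ∀ f i → U (Uᵀ f) i ≡ + 7 * f i
      Uᵀ-U     : ∀ f i → Uᵀ (U f) i ≡ + 7 * f i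
      U-≋      : ∀ {f g} → (∀ i → f i ≋ g i [ + 4 ]) → ∀ i → U f i ≋ U g i [ + 4 ]
      Uᵀ-const : ∀ {m f} t → (∀ i → f i ≋ t [ m ]) →
                 ∀ i → (Uᵀ f i ≋ + 5 * t [ m ]) ⊎ (Uᵀ f i ≋ - t [ m ])

  H-similarity : ∀ k → Similarity (suc k ℕ.* 4)
  H-similarity k = record
    { o        = 0F
    ; U        = H (suc k)
    ; Uᵀ       = Hᵀ (suc k)
    ; U-∙      = H-∙ (suc k)
    ; U-Uᵀ     = H-Hᵀ (suc k)
    ; Uᵀ-U     = Hᵀ-H (suc k)
    ; U-≋      = H-≋ (suc k)
    ; Uᵀ-const = Hᵀ-const (suc k)
    }

  -- The code of a matrix K: self-duality and Type II.

  module Construction {p : ℕ} (S : Similarity p) where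

    open Similarity S public

    left right X Y : Word (p ℕ.+ p) → Fin p → ℤ
    left  w i = coord w (i ↑ˡ p)
    right w i = coord w (p ↑ʳ i)
    Y w = U (right w)
    X w i = left w i - Y w i

    -- After the substitution a = x + y, the term y·y′ = 7 b·b′ combines with b·b′ to a multiple of
    -- 8.
    coord-∙ : ∀ v w → coord v ∙ coord w ≡ X v ∙ X w + X v ∙ Y w + X w ∙ Y v + + 8 * (right v ∙ right w)
    coord-∙ v w = begin
      coord v ∙ coord w
        ≡⟨ sum-++ p (λ i → coord v i * coord w i) ⟩
      left v ∙ left w + right v ∙ right w
        ≡⟨ cong (_+ right v ∙ right w) (sum-cong-≗ (λ i → expand (left v i) (left w i) (Y v i) (Y w i))) ⟩
      sum (λ i → X v i * X w i + X v i * Y w i + X w i * Y v i + Y v i * Y w i) + right v ∙ right w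
        ≡⟨ cong (_+ right v ∙ right w) (trans (∑-distrib-+ (λ i → X v i * X w i + X v i * Y w i + X w i * Y v i) (λ i → Y v i * Y w i))
             (cong₂ _+_ (trans (∑-distrib-+ (λ i → X v i * X w i + X v i * Y w i) (λ i → X w i * Y v i))
               (cong (_+ X w ∙ Y v) (∑-distrib-+ (λ i → X v i * X w i) (λ i → X v i * Y w i))))
               (U-∙ (right v) (right w)))) ⟩
      X v ∙ X w + X v ∙ Y w + X w ∙ Y v + + 7 * (right v ∙ right w) + right v ∙ right w
        ≡⟨ collect (X v ∙ X w + X v ∙ Y w + X w ∙ Y v) (right v ∙ right w) ⟩
      X v ∙ X w + X v ∙ Y w + X w ∙ Y v + + 8 * (right v ∙ right w) ∎
      where
      open ≡-Reasoning
      expand : ∀ a a′ y y′ → a * a′ ≡ (a - y) * (a′ - y′) + (a - y) * y′ + (a′ - y′) * y + y * y′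
      expand = solve-∀
      collect : ∀ s b → s + + 7 * b + b ≡ s + + 8 * b
      collect = solve-∀

    -- Inverse modulo 4 to w ↦ (x, y): Hb = y is solved by b = -Hᵀy, since HHᵀ = 7 ≡ -1.
    encode : (x y : Fin p → ℤ) → Word (p ℕ.+ p)
    encode x y = tabulate (λ i → residue (x i + y i)) ++ tabulate (λ i → residue (Uᵀ (λ j → - y j) i))

    Y-encode : ∀ x y i → Y (encode x y) i ≋ y i [ + 4 ]
    Y-encode x y i = ≋-trans (U-≋ {g = Uᵀ (λ j → - y j)} right-encode i)
      (≋-trans (≋-reflexive (U-Uᵀ (λ j → - y j) i)) (mod (divides (- + 2 * y i) (lemma (y i)))))
      where
      lemma : ∀ y → + 7 * - y - y ≡ - + 2 * y * + 4
      lemma = solve-∀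
      right-encode : ∀ i → right (encode x y) i ≋ Uᵀ (λ j → - y j) i [ + 4 ]
      right-encode i = subst (λ a → + toℕ a ≋ Uᵀ (λ j → - y j) i [ + 4 ])
        (sym (trans (lookup-++ʳ (tabulate (λ i → residue (x i + y i))) _ i) (lookup∘tabulate (λ i → residue (Uᵀ (λ j → - y j) i)) i)))
        (residue-≋ (Uᵀ (λ j → - y j) i))

    X-encode : ∀ x y i → X (encode x y) i ≋ x i [ + 4 ]
    X-encode x y i = ≋-trans (≋-- left-encode (Y-encode x y i)) (≋-reflexive (lemma (x i) (y i)))
      where
      lemma : ∀ x y → x + y - y ≡ x
      lemma = solve-∀
      left-encode : left (encode x y) i ≋ x i + y i [ + 4 ]
      left-encode = subst (λ a → + toℕ a ≋ x i + y i [ + 4 ])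
        (sym (trans (lookup-++ˡ (tabulate (λ i → residue (x i + y i))) _ i) (lookup∘tabulate (λ i → residue (x i + y i)) i)))
        (residue-≋ (x i + y i))

    -- The graph of K over the hyperplane Σ x = 0 has 4ᵖ⁻¹ elements; its translates by (0, t·1)
    -- supply the factor 4 that self-duality asks for.
    GraphCode : Matrix p → Code (p ℕ.+ p)
    GraphCode K w = + 4 ∣ sum (X w) × Σ ℤ₄ λ t → ∀ i → Y w i ≋ (K ⊛ X w) i + + toℕ t [ + 4 ]

    encode∈GraphCode : ∀ K x y t → sum x ≡ 0ℤ → (∀ i → y i ≡ (K ⊛ x) i + + toℕ t) → GraphCode K (encode x y)
    encode∈GraphCode K x y t sum≡0 y≡ =
        ≋⇒∣ (≋-sum (X-encode x y)) (subst (+ 4 ∣_) (sym sum≡0) (divides 0ℤ refl))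
      , t , λ i → ≋-trans (Y-encode x y i) (≋-trans (≋-reflexive (y≡ i))
          (≋-+ (≋-sym (⊛-≋ K (X-encode x y) i)) (≋-reflexive refl)))

    module _ (K : Matrix p) (skew : SkewToOnes K) where

      X-∙-Y : ∀ v w → (cw : GraphCode K w) →
              X v ∙ Y w ≋ X v ∙ (K ⊛ X w) + + toℕ (proj₁ (proj₂ cw)) * sum (X v) [ + 4 ]
      X-∙-Y v w (_ , t , eq) = ≋-trans (∙-≋ (X v) {z = λ i → (K ⊛ X w) i + + toℕ t} eq)
        (≋-reflexive (trans (∙-+ʳ (X v) (K ⊛ X w) (λ _ → + toℕ t)) (cong (_+_ (X v ∙ (K ⊛ X w))) (∙-const (X v) (+ toℕ t)))))

      -- Inserting y = Kx + t·1 into `coord-∙` leaves, modulo 4, the product (Σ x)(Σ x′) of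
      -- `polarisation` and multiples of Σ x and Σ x′.
      GraphCode-isotropic : ∀ v w → GraphCode K v → GraphCode K w → + 4 ∣ coord v ∙ coord w
      GraphCode-isotropic v w cv@(dv , t , _) cw@(dw , u , _) =
        ≋⇒∣ (≋-trans (≋-reflexive (coord-∙ v w))
          (≋-+ (≋-+ (≋-+ (≋-reflexive {a = X v ∙ X w} refl) (X-∙-Y v w cw)) (X-∙-Y w v cv)) (≋-reflexive {a = + 8 * (right v ∙ right w)} refl)))
        (subst (+ 4 ∣_) (sym (regroup (X v ∙ X w) (X v ∙ (K ⊛ X w)) (X w ∙ (K ⊛ X v)) (+ toℕ u * sum (X v)) (+ toℕ t * sum (X w)) (right v ∙ right w)))
          (∣m∣n⇒∣m+n (∣m∣n⇒∣m+n (∣m∣n⇒∣m+n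
            (subst (+ 4 ∣_) (sym (polarisation K skew (X v) (X w))) (∣m⇒∣m*n (sum (X w)) dv))
            (∣n⇒∣m*n (+ toℕ u) dv)) (∣n⇒∣m*n (+ toℕ t) dw))
            (divides (+ 2 * (right v ∙ right w)) (eight (right v ∙ right w)))))
        where
        regroup : ∀ a b c d e f → a + (b + d) + (c + e) + + 8 * f ≡ a + b + c + d + e + + 8 * f
        regroup = solve-∀
        eight : ∀ a → + 8 * a ≡ + 2 * a * + 4
        eight = solve-∀

      -- The product x·y is known only modulo 4, but it enters twice, so its contribution is known
      -- modulo 8. With Σ x = 4s the rest is 16s² + 8ts.
      GraphCode-norm : ∀ w → GraphCode K w → + 8 ∣ coord w ∙ coord w
      GraphCode-norm w cw@(divides s sum≡ , t , _) = divides (+ 2 * s * s + t′ * s + q + bb) (begin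
        coord w ∙ coord w                             ≡⟨ coord-∙ w w ⟩
        xx + xy + xy + + 8 * bb                       ≡⟨ split xx xy (xk + t′ * sum (X w)) bb ⟩
        xx + + 2 * (xy - (xk + t′ * sum (X w))) + + 2 * (xk + t′ * sum (X w)) + + 8 * bb
          ≡⟨ cong (λ z → xx + + 2 * z + + 2 * (xk + t′ * sum (X w)) + + 8 * bb) (_∣_.equality (m∣a-b (X-∙-Y w w cw))) ⟩
        xx + + 2 * (q * + 4) + + 2 * (xk + t′ * sum (X w)) + + 8 * bb
          ≡⟨ polar xx xk q t′ (sum (X w)) bb ⟩
        xx + xk + xk + + 8 * q + + 2 * (t′ * sum (X w)) + + 8 * bb
          ≡⟨ cong (λ z → z + + 8 * q + + 2 * (t′ * sum (X w)) + + 8 * bb) (polarisation K skew (X w) (X w)) ⟩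
        sum (X w) * sum (X w) + + 8 * q + + 2 * (t′ * sum (X w)) + + 8 * bb
          ≡⟨ cong (λ z → z * z + + 8 * q + + 2 * (t′ * z) + + 8 * bb) sum≡ ⟩
        s * + 4 * (s * + 4) + + 8 * q + + 2 * (t′ * (s * + 4)) + + 8 * bb
          ≡⟨ factor s q t′ bb ⟩
        (+ 2 * s * s + t′ * s + q + bb) * + 8 ∎)
        where
        open ≡-Reasoning
        t′ = + toℕ t
        q = quotient (m∣a-b (X-∙-Y w w cw))
        xx = X w ∙ X w
        xy = X w ∙ Y w
        xk = X w ∙ (K ⊛ X w)
        bb = right w ∙ right w
        split : ∀ a b c d → a + b + b + + 8 * d ≡ a + + 2 * (b - c) + + 2 * c + + 8 * d
        split = solve-∀
        polar : ∀ a b q t s d → a + + 2 * (q * + 4) + + 2 * (b + t * s) + + 8 * d ≡ a + b + b + + 8 * q + + 2 * (t * s) + + 8 * d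
        polar = solve-∀
        factor : ∀ s q t d → s * + 4 * (s * + 4) + + 8 * q + + 2 * (t * (s * + 4)) + + 8 * d ≡ (+ 2 * s * s + t * s + q + d) * + 8
        factor = solve-∀

      coord-∙-encode : ∀ w x y → coord w ∙ coord (encode x y) ≋ X w ∙ x + X w ∙ y + x ∙ Y w [ + 4 ]
      coord-∙-encode w x y = ≋-trans (≋-reflexive (coord-∙ w (encode x y)))
        (≋-trans (≋-+ (≋-+ (≋-+ (∙-≋ (X w) (X-encode x y)) (∙-≋ (X w) (Y-encode x y)))
           (≋-trans (≋-reflexive (∙-comm (X (encode x y)) (Y w))) (≋-trans (∙-≋ (Y w) (X-encode x y)) (≋-reflexive (∙-comm (Y w) x)))))
           (mod (divides (+ 2 * bb) (eight bb)))) (≋-reflexive (+-identityʳ _)))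
        where
        bb = right w ∙ right (encode x y)
        eight : ∀ a → + 8 * a - 0ℤ ≡ + 2 * a * + 4
        eight = solve-∀

      -- Testing against (0, 1) gives Σ x ≡ 0; testing against (z, Kz) with z = eᵢ - e₀
      -- gives that y - Kx is constant.
      GraphCode-maximal : ∀ w → (∀ v → GraphCode K v → + 4 ∣ coord w ∙ coord v) → GraphCode K w
      GraphCode-maximal w perp = dvd , residue (r o) , λ i → ≋-trans (≋-reflexive (restore (Y w i) ((K ⊛ X w) i)))
          (≋-+ (≋-reflexive {a = (K ⊛ X w) i} refl) (≋-trans (constant i) (≋-sym (residue-≋ (r o)))))
        where
        open ≡-Reasoning
        r : Fin p → ℤ
        r i = Y w i - (K ⊛ X w) i
        restore : ∀ a b → a ≡ b + (a - b)
        restore = solve-∀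
        0-∙ : ∀ {n} (x : Fin n → ℤ) → (λ _ → 0ℤ) ∙ x ≡ 0ℤ
        0-∙ x = trans (∙-comm (λ _ → 0ℤ) x) (trans (∙-const x 0ℤ) (*-zeroˡ (sum x)))
        dvd : + 4 ∣ sum (X w)
        dvd = ≋⇒∣ (≋-trans (≋-reflexive (begin
            sum (X w)
              ≡⟨ sym (trans (cong₂ _+_ (cong₂ _+_ (trans (∙-comm (X w) (λ _ → 0ℤ)) (0-∙ (X w))) (∙-const (X w) 1ℤ)) (0-∙ (Y w))) (lemma (sum (X w)))) ⟩
            X w ∙ (λ _ → 0ℤ) + X w ∙ (λ _ → 1ℤ) + (λ _ → 0ℤ) ∙ Y w ∎))
            (≋-sym (coord-∙-encode w (λ _ → 0ℤ) (λ _ → 1ℤ))))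
          (perp (encode (λ _ → 0ℤ) (λ _ → 1ℤ)) (encode∈GraphCode K (λ _ → 0ℤ) (λ _ → 1ℤ) 1F (sum-replicate-zero p)
            (λ i → cong (_+ 1ℤ) (sym (trans (∙-comm (K i) (λ _ → 0ℤ)) (0-∙ (K i)))))))
          where lemma : ∀ a → 0ℤ + 1ℤ * a + 0ℤ ≡ a
                lemma = solve-∀
        -- As Σ z = 0, `polarisation` turns x·z + x·Kz into -z·Kx, so the inner product of `w` with
        -- (z, Kz) is z·(y - Kx) = `r i - r o`.
        constant : ∀ i → r i ≋ r o [ + 4 ]
        constant i = mod (≋⇒∣ (≋-trans (≋-reflexive (begin
            r i - r o ≡⟨ cong₂ _-_ (δ-∙ i r) (δ-∙ o r) ⟨
            δ i ∙ r - δ o ∙ r ≡⟨ ∙-diff (δ i) (δ o) r ⟩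
            z ∙ r ≡⟨ cancel (z ∙ (K ⊛ X w)) (z ∙ r) ⟩
            z ∙ (K ⊛ X w) + z ∙ r - z ∙ (K ⊛ X w) ≡⟨ cong (_- z ∙ (K ⊛ X w)) (sym (∙-+ʳ z (K ⊛ X w) r)) ⟩
            z ∙ (λ j → (K ⊛ X w) j + r j) - z ∙ (K ⊛ X w)
              ≡⟨ cong (_- z ∙ (K ⊛ X w)) (sum-cong-≗ (λ j → cong (z j *_) (sym (restore (Y w j) ((K ⊛ X w) j))))) ⟩
            z ∙ Y w - z ∙ (K ⊛ X w)
              ≡⟨ regroup (X w ∙ z) (X w ∙ (K ⊛ z)) (z ∙ (K ⊛ X w)) (z ∙ Y w) ⟩
            X w ∙ z + X w ∙ (K ⊛ z) + z ∙ Y w - (X w ∙ z + X w ∙ (K ⊛ z) + z ∙ (K ⊛ X w))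
              ≡⟨ cong (_-_ (X w ∙ z + X w ∙ (K ⊛ z) + z ∙ Y w)) (trans (polarisation K skew (X w) z) (trans (cong (sum (X w) *_) sum-z) (*-zeroʳ (sum (X w))))) ⟩
            X w ∙ z + X w ∙ (K ⊛ z) + z ∙ Y w - 0ℤ
              ≡⟨ +-identityʳ _ ⟩
            X w ∙ z + X w ∙ (K ⊛ z) + z ∙ Y w ∎))
            (≋-sym (coord-∙-encode w z (K ⊛ z))))
          (perp (encode z (K ⊛ z)) (encode∈GraphCode K z (K ⊛ z) 0F sum-z (λ j → sym (+-identityʳ _)))))
          where
          z : Fin p → ℤ
          z j = δ i j - δ o j
          cancel : ∀ a b → b ≡ a + b - a
          cancel = solve-∀
          regroup : ∀ a b c d → d - c ≡ a + b + d - (a + b + c)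
          regroup = solve-∀
          ∙-diff : ∀ {n} (x y z : Fin n → ℤ) → x ∙ z - y ∙ z ≡ (λ j → x j - y j) ∙ z
          ∙-diff {zero}  x y z = refl
          ∙-diff {suc n} x y z = trans (lemma (x 0F) (y 0F) (z 0F) _ _) (cong (_+_ ((x 0F - y 0F) * z 0F)) (∙-diff (x ∘ suc) (y ∘ suc) (z ∘ suc)))
            where lemma : ∀ a b c s t → a * c + s - (b * c + t) ≡ (a - b) * c + (s - t)
                  lemma = solve-∀
          sum-z : sum z ≡ 0ℤ
          sum-z = begin
            sum z ≡⟨ sum-cong-≗ (λ j → sym (*-identityʳ (z j))) ⟩
            z ∙ (λ _ → 1ℤ) ≡⟨ ∙-diff (δ i) (δ o) (λ _ → 1ℤ) ⟨
            δ i ∙ (λ _ → 1ℤ) - δ o ∙ (λ _ → 1ℤ) ≡⟨ cong₂ _-_ (δ-∙ i (λ _ → 1ℤ)) (δ-∙ o (λ _ → 1ℤ)) ⟩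
            0ℤ ∎

      GraphCode-typeII : IsTypeII (GraphCode K)
      GraphCode-typeII = (selfDual⇒submodule (GraphCode K) dual , dual) , λ w cw →
          ∣⇒∣ᵤ (≋⇒∣ (euclidNorm-coord w) (GraphCode-norm w cw))
        where
        dual : ∀ v → GraphCode K v ⇔ (∀ w → GraphCode K w → Orthogonal v w)
        dual v = mk⇔ (λ cv w cw → ∣inner⇒Orthogonal v w (GraphCode-isotropic v w cv cw))
          (λ perp → GraphCode-maximal v (λ w cw → Orthogonal⇒∣inner v w (perp w cw)))

-- Finite sums, products and indicators.

module Sums where

  open import Data.Nat
  open import Data.Nat.Properties

  private variable
    A B P Q : Set

  ∑ : List A → (A → ℕ) → ℕ
  ∑ []       f = 0
  ∑ (x ∷ xs) f = f x + ∑ xs f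

  ∑-mono : ∀ (xs : List A) {f g} → (∀ x → f x ≤ g x) → ∑ xs f ≤ ∑ xs g
  ∑-mono []       f≤g = z≤n
  ∑-mono (x ∷ xs) f≤g = +-mono-≤ (f≤g x) (∑-mono xs f≤g)

  ∑-cong : ∀ (xs : List A) {f g} → (∀ x → f x ≡ g x) → ∑ xs f ≡ ∑ xs g
  ∑-cong []       f≡g = refl
  ∑-cong (x ∷ xs) f≡g = cong₂ _+_ (f≡g x) (∑-cong xs f≡g)

  ∑-distrib-+ : ∀ (xs : List A) f g → ∑ xs (λ x → f x + g x) ≡ ∑ xs f + ∑ xs g
  ∑-distrib-+ []       f g = refl
  ∑-distrib-+ (x ∷ xs) f g = trans (cong (f x + g x +_) (∑-distrib-+ xs f g)) (lemma (f x) (g x) (∑ xs f) (∑ xs g))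
    where lemma : ∀ a b c d → a + b + (c + d) ≡ a + c + (b + d)
          lemma = solve-∀ℕ

  ∑-distribˡ-* : ∀ (xs : List A) c f → ∑ xs (λ x → c * f x) ≡ c * ∑ xs f
  ∑-distribˡ-* []       c f = sym (*-zeroʳ c)
  ∑-distribˡ-* (x ∷ xs) c f = trans (cong (c * f x +_) (∑-distribˡ-* xs c f)) (sym (*-distribˡ-+ c (f x) (∑ xs f)))

  ∑-distribʳ-* : ∀ (xs : List A) f c → ∑ xs (λ x → f x * c) ≡ ∑ xs f * c
  ∑-distribʳ-* xs f c = trans (∑-cong xs (λ x → *-comm (f x) c)) (trans (∑-distribˡ-* xs c f) (*-comm c (∑ xs f)))

  ∑-const : ∀ (xs : List A) c → ∑ xs (λ _ → c) ≡ length xs * c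
  ∑-const []       c = refl
  ∑-const (x ∷ xs) c = cong (c +_) (∑-const xs c)

  ∑-≤-const : ∀ (xs : List A) {f c} → (∀ x → f x ≤ c) → ∑ xs f ≤ length xs * c
  ∑-≤-const xs {c = c} f≤c = ≤-trans (∑-mono xs f≤c) (≤-reflexive (∑-const xs c))

  ∑-comm : ∀ (xs : List A) (ys : List B) (f : A → B → ℕ) → ∑ xs (λ x → ∑ ys (f x)) ≡ ∑ ys (λ y → ∑ xs (λ x → f x y))
  ∑-comm []       ys f = sym (trans (∑-const ys 0) (*-zeroʳ (length ys)))
  ∑-comm (x ∷ xs) ys f = trans (cong (∑ ys (f x) +_) (∑-comm xs ys f)) (sym (∑-distrib-+ ys (f x) (λ y → ∑ xs (λ x → f x y))))

  ∑-++ : ∀ (xs ys : List A) f → ∑ (xs List.++ ys) f ≡ ∑ xs f + ∑ ys f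
  ∑-++ []       ys f = refl
  ∑-++ (x ∷ xs) ys f = trans (cong (f x +_) (∑-++ xs ys f)) (sym (+-assoc (f x) (∑ xs f) (∑ ys f)))

  ∑-map : ∀ (h : A → B) xs f → ∑ (List.map h xs) f ≡ ∑ xs (f ∘ h)
  ∑-map h []       f = refl
  ∑-map h (x ∷ xs) f = cong (f (h x) +_) (∑-map h xs f)

  ∑≡0⇒≡0 : ∀ {xs : List A} {f x} → ∑ xs f ≡ 0 → x ∈ xs → f x ≡ 0
  ∑≡0⇒≡0 {f = f} s (here refl) = m+n≡0⇒m≡0 (f _) s
  ∑≡0⇒≡0 {xs = y ∷ _} {f} s (there x∈xs) = ∑≡0⇒≡0 (m+n≡0⇒n≡0 (f y) s) x∈xs

  -- The first-moment principle: an average below 1 forces some natural number among the values to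
  -- be 0.
  ∑<length⇒∃≡0 : ∀ (xs : List A) f → ∑ xs f < length xs → ∃ λ x → x ∈ xs × f x ≡ 0
  ∑<length⇒∃≡0 (x ∷ xs) f lt with f x in eq
  ... | zero  = x , here refl , eq
  ... | suc n with ∑<length⇒∃≡0 xs f (≤-trans (s≤s (m≤n+m (∑ xs f) n)) (s≤s⁻¹ lt))
  ...   | y , y∈xs , fy≡0 = y , there y∈xs , fy≡0

  vecs : List A → ∀ n → List (Vec A n)
  vecs xs zero    = [] ∷ []
  vecs xs (suc n) = cartesianProductWith _∷_ xs (vecs xs n)

  ∈-vecs : ∀ {xs : List A} → (∀ x → x ∈ xs) → ∀ {n} (v : Vec A n) → v ∈ vecs xs n
  ∈-vecs all []      = here refl
  ∈-vecs all (x ∷ v) = ∈-cartesianProductWith⁺ _∷_ (all x) (∈-vecs all v)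

  length-vecs : ∀ (xs : List A) n → length (vecs xs n) ≡ length xs ^ n
  length-vecs xs zero    = refl
  length-vecs {A} xs (suc n) = go xs
    where
    go : ∀ (ys : List A) → length (cartesianProductWith _∷_ ys (vecs xs n)) ≡ length ys * length xs ^ n
    go []       = refl
    go (y ∷ ys) = trans (List.length-++ (List.map (y ∷_) (vecs xs n)))
      (cong₂ _+_ (trans (List.length-map (y ∷_) (vecs xs n)) (length-vecs xs n)) (go ys))

  ∑-vecs-suc : ∀ (xs : List A) n f → ∑ (vecs xs (suc n)) f ≡ ∑ xs (λ x → ∑ (vecs xs n) (λ v → f (x ∷ v)))
  ∑-vecs-suc {A} xs n f = go xs
    where
    go : ∀ (ys : List A) → ∑ (cartesianProductWith _∷_ ys (vecs xs n)) f ≡ ∑ ys (λ x → ∑ (vecs xs n) (λ v → f (x ∷ v)))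
    go []       = refl
    go (y ∷ ys) = trans (∑-++ (List.map (y ∷_) (vecs xs n)) _ f) (cong₂ _+_ (∑-map (y ∷_) (vecs xs n) f) (go ys))

  -- The vectors split into lines parallel to axis `k`, each contributing at most `c`. The factor
  -- `length xs` on the left replaces the exponent n - 1 by n.
  ∑-vecs-line : ∀ (xs : List A) {n} (k : Fin n) f c → (∀ v → ∑ xs (λ x → f (v [ k ]≔ x)) ≤ c) →
                length xs * ∑ (vecs xs n) f ≤ length xs ^ n * c
  ∑-vecs-line [] {suc n} k f c h = z≤n
  ∑-vecs-line xs@(x₀ ∷ _) {suc n} zero f c h = begin
    length xs * ∑ (vecs xs (suc n)) f                            ≡⟨ cong (length xs *_) (∑-vecs-suc xs n f) ⟩
    length xs * ∑ xs (λ x → ∑ (vecs xs n) (λ v → f (x ∷ v)))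
      ≡⟨ cong (length xs *_) (∑-comm xs (vecs xs n) (λ x v → f (x ∷ v))) ⟩
    length xs * ∑ (vecs xs n) (λ v → ∑ xs (λ x → f (x ∷ v)))
      -- The head `x₀` is a placeholder, overwritten by the update at position 0.
      ≤⟨ *-monoʳ-≤ (length xs) (∑-≤-const (vecs xs n) (λ v → h (x₀ ∷ v))) ⟩
    length xs * (length (vecs xs n) * c)
      ≡⟨ cong (λ l → length xs * (l * c)) (length-vecs xs n) ⟩
    length xs * (length xs ^ n * c)                              ≡⟨ *-assoc (length xs) (length xs ^ n) c ⟨
    length xs ^ suc n * c                                        ∎
    where open ≤-Reasoning
  ∑-vecs-line xs {suc n} (suc k) f c h = begin
    length xs * ∑ (vecs xs (suc n)) f                            ≡⟨ cong (length xs *_) (∑-vecs-suc xs n f) ⟩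
    length xs * ∑ xs (λ x → ∑ (vecs xs n) (λ v → f (x ∷ v)))
      ≡⟨ ∑-distribˡ-* xs (length xs) (λ x → ∑ (vecs xs n) (λ v → f (x ∷ v))) ⟨
    ∑ xs (λ x → length xs * ∑ (vecs xs n) (λ v → f (x ∷ v)))
      ≤⟨ ∑-≤-const xs (λ x → ∑-vecs-line xs k (λ v → f (x ∷ v)) c (λ v → h (x ∷ v))) ⟩
    length xs * (length xs ^ n * c)                              ≡⟨ *-assoc (length xs) (length xs ^ n) c ⟨
    length xs ^ suc n * c                                        ∎
    where open ≤-Reasoning

  ∏ : ∀ {n} → (Fin n → ℕ) → ℕ
  ∏ {zero}  f = 1
  ∏ {suc n} f = f zero * ∏ (f ∘ suc)

  ∏-≡1 : ∀ {n} {f : Fin n → ℕ} → (∀ i → f i ≡ 1) → ∏ f ≡ 1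
  ∏-≡1 {zero}  h = refl
  ∏-≡1 {suc n} h = cong₂ _*_ (h zero) (∏-≡1 (h ∘ suc))

  ∏-≤-^ : ∀ {n} {f : Fin n → ℕ} {s} → (∀ i → f i ≤ s) → ∏ f ≤ s ^ n
  ∏-≤-^ {zero}  h = ≤-refl
  ∏-≤-^ {suc n} h = *-mono-≤ (h zero) (∏-≤-^ (h ∘ suc))

  -- A surplus factor `s` ≥ 1 is allowed, which keeps the exponent at n instead of n - 1.
  ∏-≤-except : ∀ {n} {f : Fin n → ℕ} {s c} k → 1 ≤ s → f k ≤ c → (∀ i → i ≢ k → f i ≤ s) → ∏ f ≤ c * s ^ n
  ∏-≤-except {suc n} {s = s} zero 1≤s hk h =
    *-mono-≤ hk (≤-trans (∏-≤-^ (λ i → h (suc i) λ ())) (m≤n*m (s ^ n) s {{>-nonZero 1≤s}}))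
  ∏-≤-except {suc n} {s = s} {c} (suc k) 1≤s hk h =
    ≤-trans (*-mono-≤ (h zero λ ()) (∏-≤-except k 1≤s hk (λ i i≢k → h (suc i) (λ { refl → i≢k refl }))))
      (≤-reflexive (lemma s c (s ^ n)))
    where lemma : ∀ a b c → a * (b * c) ≡ b * (a * c)
          lemma = solve-∀ℕ

  -- Distributivity; in probabilistic terms, the entries of a uniform random vector are independent.
  ∑-∏ : ∀ (xs : List A) n (g : Fin n → A → ℕ) → ∑ (vecs xs n) (λ v → ∏ (λ i → g i (lookup v i))) ≡ ∏ (λ i → ∑ xs (g i))
  ∑-∏ xs zero    g = refl
  ∑-∏ xs (suc n) g = begin
    ∑ (vecs xs (suc n)) (λ v → ∏ (λ i → g i (lookup v i)))
      ≡⟨ ∑-vecs-suc xs n (λ v → ∏ (λ i → g i (lookup v i))) ⟩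
    ∑ xs (λ x → ∑ (vecs xs n) (λ v → g zero x * ∏ (λ i → g (suc i) (lookup v i))))
      ≡⟨ ∑-cong xs (λ x → trans (∑-distribˡ-* (vecs xs n) (g zero x) _) (cong (g zero x *_) (∑-∏ xs n (g ∘ suc)))) ⟩
    ∑ xs (λ x → g zero x * ∏ (λ i → ∑ xs (g (suc i))))
      ≡⟨ ∑-distribʳ-* xs (g zero) _ ⟩
    ∑ xs (g zero) * ∏ (λ i → ∑ xs (g (suc i))) ∎
    where open ≡-Reasoning

  ⟦_⟧ : Dec P → ℕ
  ⟦ yes _ ⟧ = 1
  ⟦ no _ ⟧  = 0

  ⟦⟧≤1 : (d : Dec P) → ⟦ d ⟧ ≤ 1
  ⟦⟧≤1 (yes _) = ≤-refl
  ⟦⟧≤1 (no _)  = z≤n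

  ⟦⟧-true : (d : Dec P) → P → ⟦ d ⟧ ≡ 1
  ⟦⟧-true (yes _) p = refl
  ⟦⟧-true (no ¬p) p = contradiction p ¬p

  ⟦⟧-false : (d : Dec P) → ¬ P → ⟦ d ⟧ ≡ 0
  ⟦⟧-false (yes p) ¬p = contradiction p ¬p
  ⟦⟧-false (no _)  ¬p = refl

  ⟦⟧≡0⇒¬ : (d : Dec P) → ⟦ d ⟧ ≡ 0 → ¬ P
  ⟦⟧≡0⇒¬ (no ¬p) _ = ¬p

  ⟦⟧-≤ : (d : Dec P) {m : ℕ} → (P → 1 ≤ m) → ⟦ d ⟧ ≤ m
  ⟦⟧-≤ (yes p) h = h p
  ⟦⟧-≤ (no _)  h = z≤n

  ⟦⟧-mono : (d : Dec P) (e : Dec Q) → (P → Q) → ⟦ d ⟧ ≤ ⟦ e ⟧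
  ⟦⟧-mono d e h = ⟦⟧-≤ d (λ p → ≤-reflexive (sym (⟦⟧-true e (h p))))

  ∈⇒≤∑ : ∀ {xs : List A} {x} f → x ∈ xs → f x ≤ ∑ xs f
  ∈⇒≤∑ f (here refl)  = m≤m+n (f _) _
  ∈⇒≤∑ f (there x∈xs) = ≤-trans (∈⇒≤∑ f x∈xs) (m≤n+m _ (f _))

  -- Both sides have the same number of factors, and f - e factors `u` on the left become `v` on the
  -- right.
  ^-exchange : ∀ {u v e e′ f f′} → u ≤ v → e ≤ f → e + e′ ≡ f + f′ → u ^ f * v ^ f′ ≤ u ^ e * v ^ e′
  ^-exchange {u} {v} {e} {e′} {f} {f′} u≤v e≤f eq = begin
    u ^ f * v ^ f′             ≡⟨ cong (λ x → u ^ x * v ^ f′) (m+[n∸m]≡n e≤f) ⟨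
    u ^ (e + d) * v ^ f′       ≡⟨ cong (_* v ^ f′) (^-distribˡ-+-* u e d) ⟩
    u ^ e * u ^ d * v ^ f′     ≤⟨ *-monoˡ-≤ (v ^ f′) (*-monoʳ-≤ (u ^ e) (^-monoˡ-≤ d u≤v)) ⟩
    u ^ e * v ^ d * v ^ f′     ≡⟨ *-assoc (u ^ e) (v ^ d) (v ^ f′) ⟩
    u ^ e * (v ^ d * v ^ f′)   ≡⟨ cong (u ^ e *_) (^-distribˡ-+-* v d f′) ⟨
    u ^ e * v ^ (d + f′)       ≡⟨ cong (λ x → u ^ e * v ^ x) (+-cancelˡ-≡ e _ _ (begin-equality
      e + (d + f′) ≡⟨ +-assoc e d f′ ⟨
      e + d + f′   ≡⟨ cong (_+ f′) (m+[n∸m]≡n e≤f) ⟩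
      f + f′       ≡⟨ eq ⟨
      e + e′       ∎)) ⟩
    u ^ e * v ^ e′             ∎
    where open ≤-Reasoning
          d = f ∸ e

  ^-distribʳ-* : ∀ m n o → (m * n) ^ o ≡ m ^ o * n ^ o
  ^-distribʳ-* m n zero    = refl
  ^-distribʳ-* m n (suc o) = trans (cong (m * n *_) (^-distribʳ-* m n o)) (lemma m n (m ^ o) (n ^ o))
    where lemma : ∀ a b c d → a * b * (c * d) ≡ a * c * (b * d)
          lemma = solve-∀ℕ

  -- Chernoff's bound for balls of weighted words.

  weight : (A → ℕ) → ∀ {n} → Vec A n → ℕ
  weight e v = foldr (λ _ → ℕ) _+_ 0 (map e v)

  ∏ᵛ : (A → ℕ) → ∀ {n} → Vec A n → ℕ
  ∏ᵛ g v = foldr (λ _ → ℕ) _*_ 1 (map g v)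

  -- Letters are counted with multiplicity `g` and have weight `e`. The complementary weight `e′`
  -- makes the enumerator homogeneous, so that its value at z = a/c stays in the natural numbers.
  module Ball (xs : List A) (g e e′ : A → ℕ) (m : ℕ) (e+e′≡m : ∀ x → e x + e′ x ≡ m)
              (a c B : ℕ) (generating : ∑ xs (λ x → g x * (a ^ e x * c ^ e′ x)) ≡ B) where

    weight+weight : ∀ {n} (v : Vec A n) → weight e v + weight e′ v ≡ n * m
    weight+weight []      = refl
    weight+weight (x ∷ v) = trans (lemma (e x) (weight e v) (e′ x) (weight e′ v)) (cong₂ _+_ (e+e′≡m x) (weight+weight v))
      where lemma : ∀ a b c d → a + b + (c + d) ≡ a + c + (b + d)
            lemma = solve-∀ℕ

    generating-vecs : ∀ n → ∑ (vecs xs n) (λ v → ∏ᵛ g v * (a ^ weight e v * c ^ weight e′ v)) ≡ B ^ n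
    generating-vecs zero    = refl
    generating-vecs (suc n) = begin
      ∑ (vecs xs (suc n)) F                                     ≡⟨ ∑-vecs-suc xs n F ⟩
      ∑ xs (λ x → ∑ (vecs xs n) (λ v → F (x ∷ v)))
        ≡⟨ ∑-cong xs (λ x → trans (∑-cong (vecs xs n) (factor x)) (∑-distribˡ-* (vecs xs n) (f x) F)) ⟩
      ∑ xs (λ x → f x * ∑ (vecs xs n) F)                        ≡⟨ ∑-distribʳ-* xs f _ ⟩
      ∑ xs f * ∑ (vecs xs n) F                                  ≡⟨ cong₂ _*_ generating (generating-vecs n) ⟩
      B ^ suc n                                                 ∎
      where
      open ≡-Reasoning
      f : A → ℕ
      f x = g x * (a ^ e x * c ^ e′ x)
      F : ∀ {n} → Vec A n → ℕ
      F v = ∏ᵛ g v * (a ^ weight e v * c ^ weight e′ v)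
      lemma : ∀ g G a A c C → g * G * ((a * A) * (c * C)) ≡ g * (a * c) * (G * (A * C))
      lemma = solve-∀ℕ
      factor : ∀ {n} x (v : Vec A n) → F (x ∷ v) ≡ f x * F v
      factor x v = trans (cong₂ (λ s t → g x * ∏ᵛ g v * (s * t)) (^-distribˡ-+-* a (e x) (weight e v)) (^-distribˡ-+-* c (e′ x) (weight e′ v)))
        (lemma (g x) (∏ᵛ g v) (a ^ e x) (a ^ weight e v) (c ^ e′ x) (c ^ weight e′ v))

    ball : ℕ → ℕ → ℕ
    ball n L = ∑ (vecs xs n) (λ v → ∏ᵛ g v * ⟦ weight e v ≤? L ⟧)

    -- As a ≤ c, the monomial of a word in the ball is at least that of weight `L`, and the sum of
    -- all monomials is `B ^ n`.
    ball-bound : a ≤ c → ∀ n L → L ≤ n * m → ball n L * (a ^ L * c ^ (n * m ∸ L)) ≤ B ^ n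
    ball-bound a≤c n L L≤nm = begin
      ball n L * (a ^ L * c ^ L′)
        ≡⟨ ∑-distribʳ-* (vecs xs n) (λ v → ∏ᵛ g v * ⟦ weight e v ≤? L ⟧) _ ⟨
      ∑ (vecs xs n) (λ v → ∏ᵛ g v * ⟦ weight e v ≤? L ⟧ * (a ^ L * c ^ L′))
        ≤⟨ ∑-mono (vecs xs n) (λ v → ≤-trans (≤-reflexive (*-assoc (∏ᵛ g v) _ _)) (*-monoʳ-≤ (∏ᵛ g v) (term v))) ⟩
      ∑ (vecs xs n) (λ v → ∏ᵛ g v * (a ^ weight e v * c ^ weight e′ v))
        ≡⟨ generating-vecs n ⟩
      B ^ n ∎
      where
      open ≤-Reasoning
      L′ = n * m ∸ L
      term : ∀ v → ⟦ weight e v ≤? L ⟧ * (a ^ L * c ^ L′) ≤ a ^ weight e v * c ^ weight e′ v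
      term v with weight e v ≤? L
      ... | no _    = z≤n
      ... | yes w≤L = ≤-trans (≤-reflexive (*-identityˡ _))
        (^-exchange a≤c w≤L (trans (weight+weight v) (sym (m+[n∸m]≡n L≤nm))))

    -- With b = a + c and λ = a / b, the radius is at most λnm, and aᵃ cᶜ = (b λ^λ (1 - λ)^(1 - λ))ᵇ.
    ball-entropy : a ≤ c → ∀ n L → (a + c) * L ≤ a * (n * m) → .{{NonZero (a + c)}} →
                   ball n L ^ (a + c) * (a ^ a * c ^ c) ^ (n * m) ≤ (B ^ (a + c)) ^ n
    ball-entropy a≤c n L bL≤ = begin
      ball n L ^ b * (a ^ a * c ^ c) ^ (n * m)
        ≡⟨ cong (ball n L ^ b *_) (trans (^-distribʳ-* (a ^ a) (c ^ c) (n * m)) (cong₂ _*_ (^-*-assoc a a (n * m)) (^-*-assoc c c (n * m)))) ⟩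
      ball n L ^ b * (a ^ (a * (n * m)) * c ^ (c * (n * m)))
        ≤⟨ *-monoʳ-≤ (ball n L ^ b) (^-exchange a≤c Lb≤ Lb+L′b) ⟩
      ball n L ^ b * (a ^ (L * b) * c ^ ((n * m ∸ L) * b))
        ≡⟨ cong (ball n L ^ b *_) (trans (^-distribʳ-* (a ^ L) (c ^ (n * m ∸ L)) b) (cong₂ _*_ (^-*-assoc a L b) (^-*-assoc c (n * m ∸ L) b))) ⟨
      ball n L ^ b * (a ^ L * c ^ (n * m ∸ L)) ^ b
        ≡⟨ ^-distribʳ-* (ball n L) _ b ⟨
      (ball n L * (a ^ L * c ^ (n * m ∸ L))) ^ b
        ≤⟨ ^-monoˡ-≤ b (ball-bound a≤c n L L≤nm) ⟩
      (B ^ n) ^ b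
        ≡⟨ trans (^-*-assoc B n b) (trans (cong (B ^_) (*-comm n b)) (sym (^-*-assoc B b n))) ⟩
      (B ^ b) ^ n ∎
      where
      open ≤-Reasoning
      b = a + c
      Lb≤ : L * b ≤ a * (n * m)
      Lb≤ = ≤-trans (≤-reflexive (*-comm L b)) bL≤
      L≤nm : L ≤ n * m
      L≤nm = *-cancelˡ-≤ b (≤-trans bL≤ (*-monoˡ-≤ (n * m) (m≤m+n a c)))
      Lb+L′b : L * b + (n * m ∸ L) * b ≡ a * (n * m) + c * (n * m)
      Lb+L′b = trans (sym (*-distribʳ-+ b L (n * m ∸ L))) (trans (cong (_* b) (m+[n∸m]≡n L≤nm))
        (trans (*-comm (n * m) b) (*-distribʳ-+ (n * m) a c)))

-- Random matrices K, shifted from a fixed one by R - Rᵀ.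

module RandomCodes where

  open import Data.Integer hiding (suc)
  open import Data.Integer.Properties
  open import Data.Integer.Divisibility.Signed
  open import Data.Integer.Tactic.RingSolver using (solve-∀)
  open GraphCodes
  open Sums hiding (∑-distrib-+; ∑-comm)

  infix 4 _≋?_[_]
  _≋?_[_] : ∀ a b m → Dec (a ≋ b [ m ])
  a ≋? b [ m ] = map′ mod m∣a-b (m ∣? a - b)

  -- The strictly lower triangular matrix of ones: a base point from which all K with K + Kᵀ = J - I
  -- differ by a skew-symmetric matrix.
  lower : ∀ {n} → Matrix n
  lower zero    j       = 0ℤ
  lower (suc i) zero    = 1ℤ
  lower (suc i) (suc j) = lower i j

  lower-skew : ∀ {n} → SkewToOnes (lower {n})
  lower-skew zero    zero    = refl
  lower-skew zero    (suc j) = refl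
  lower-skew (suc i) zero    = refl
  lower-skew (suc i) (suc j) = lower-skew i j

  -- Stored by columns, because the averaging varies one column with the others fixed.
  Columns : ℕ → Set
  Columns n = Vec (Vec ℤ₄ n) n

  entry : ∀ {n} → Columns n → Matrix n
  entry R i j = coord (lookup R j) i

  matrix : ∀ {n} → Columns n → Matrix n
  matrix R i j = lower i j + (entry R i j - entry R j i)

  matrix-skew : ∀ {n} (R : Columns n) → SkewToOnes (matrix R)
  matrix-skew R i j = trans (lemma (δ i j) (lower i j) (lower j i) (entry R i j) (entry R j i)) (lower-skew i j)
    where lemma : ∀ d a b r s → d + (a + (r - s)) + (b + (s - r)) ≡ d + a + b
          lemma = solve-∀

  δ-refl : ∀ {n} (i : Fin n) → δ i i ≡ 1ℤ
  δ-refl zero    = refl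
  δ-refl (suc i) = δ-refl i

  δ-≢ : ∀ {n} {i j : Fin n} → i ≢ j → δ i j ≡ 0ℤ
  δ-≢ {i = zero}  {zero}  i≢j = contradiction refl i≢j
  δ-≢ {i = zero}  {suc j} i≢j = refl
  δ-≢ {i = suc i} {zero}  i≢j = refl
  δ-≢ {i = suc i} {suc j} i≢j = δ-≢ (i≢j ∘ cong suc)

  -- Column `k` of R meets row i ≠ k of R only at position `k`, and becomes row `k` of Rᵀ, away from
  -- row `i`.
  matrix-update : ∀ {n} (R : Columns n) k v {i} → i ≢ k → ∀ j →
                  matrix (R [ k ]≔ v) i j ≡ matrix R i j + δ k j * (coord v i - entry R i k)
  matrix-update R k v {i} i≢k j with k Fin.≟ j
  ... | yes refl = trans
    (cong₂ (λ a b → lower i j + (coord a i - coord b j)) (lookup∘updateAt j R) (lookup∘updateAt′ i j i≢k R))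
    (trans (lemma (lower i j) (coord v i) (entry R j i) (entry R i j))
      (cong (λ d → matrix R i j + d * (coord v i - entry R i j)) (sym (δ-refl j))))
    where lemma : ∀ l v s r → l + (v - s) ≡ l + (r - s) + 1ℤ * (v - r)
          lemma = solve-∀
  ... | no k≢j = trans
    (cong₂ (λ a b → lower i j + (coord a i - coord b j)) (lookup∘updateAt′ j k (k≢j ∘ sym) R) (lookup∘updateAt′ i k i≢k R))
    (trans (lemma (matrix R i j) (coord v i - entry R i k))
      (cong (λ d → matrix R i j + d * (coord v i - entry R i k)) (sym (δ-≢ k≢j))))
    where lemma : ∀ m d → m ≡ m + 0ℤ * d
          lemma = solve-∀

  matrix-update-⊛ : ∀ {n} (R : Columns n) k v {i} → i ≢ k → ∀ x →
                    (matrix (R [ k ]≔ v) ⊛ x) i ≡ (matrix R ⊛ x) i + (coord v i - entry R i k) * x k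
  matrix-update-⊛ R k v {i} i≢k x = begin
    sum (λ j → matrix (R [ k ]≔ v) i j * x j)
      ≡⟨ sum-cong-≗ (λ j → trans (cong (_* x j) (matrix-update R k v i≢k j)) (lemma (matrix R i j) (δ k j) d (x j))) ⟩
    sum (λ j → matrix R i j * x j + d * (δ k j * x j))
      ≡⟨ ∑-distrib-+ (λ j → matrix R i j * x j) (λ j → d * (δ k j * x j)) ⟩
    (matrix R ⊛ x) i + sum (λ j → d * (δ k j * x j))
      ≡⟨ cong (_+_ ((matrix R ⊛ x) i)) (trans (sym (*-distribˡ-sum d (λ j → δ k j * x j))) (cong (d *_) (δ-∙ k x))) ⟩
    (matrix R ⊛ x) i + d * x k ∎
    where
    open ≡-Reasoning
    d = coord v i - entry R i k
    lemma : ∀ a b c x → (a + b * c) * x ≡ a * x + c * (b * x)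
    lemma = solve-∀

  -- Linear congruences modulo 4, and parity and Lee weight of letters.

  Solutions≤ : ℕ → ℤ → Set
  Solutions≤ s x = ∀ c → ∑ (allFin 4) (λ a → ⟦ + 4 ∣? c - + toℕ a * x ⟧) ℕ.≤ s

  -- Passing to residues leaves finitely many cases, so the two bounds below are settled by
  -- enumeration.
  solutions-residue : ∀ {s} x → (∀ (c : ℤ₄) → ∑ (allFin 4) (λ a → ⟦ + 4 ∣? + toℕ c - + toℕ a * + toℕ (residue x) ⟧) ℕ.≤ s) → Solutions≤ s x
  solutions-residue x h c = ℕ.≤-trans
    (∑-mono (allFin 4) (λ a → ⟦⟧-mono (+ 4 ∣? c - + toℕ a * x) (+ 4 ∣? + toℕ (residue c) - + toℕ a * + toℕ (residue x))
      (≋⇒∣ (≋-- (residue-≋ c) (≋-* (+ toℕ a) (residue-≋ x))))))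
    (h (residue c))

  ∣-residue : ∀ {m} x → m ∣ + 4 → m ∣ + toℕ (residue x) → m ∣ x
  ∣-residue x m∣4 m∣r = ≋⇒∣ (mod (∣-trans m∣4 (m∣a-b (≋-sym (residue-≋ x))))) m∣r

  odd⇒solutions≤1 : ∀ x → ¬ + 2 ∣ x → Solutions≤ 1 x
  odd⇒solutions≤1 x odd = solutions-residue x
    (from-yes (all? λ (r : ℤ₄) → ¬? (+ 2 ∣? + toℕ r) →-dec all? λ (c : ℤ₄) → ∑ (allFin 4) (λ a → ⟦ + 4 ∣? + toℕ c - + toℕ a * + toℕ r ⟧) ℕ.≤? 1)
      (residue x) (odd ∘ ∣-residue x (divides (+ 2) refl)))

  nonzero⇒solutions≤2 : ∀ x → ¬ + 4 ∣ x → Solutions≤ 2 x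
  nonzero⇒solutions≤2 x nz = solutions-residue x
    (from-yes (all? λ (r : ℤ₄) → ¬? (+ 4 ∣? + toℕ r) →-dec all? λ (c : ℤ₄) → ∑ (allFin 4) (λ a → ⟦ + 4 ∣? + toℕ c - + toℕ a * + toℕ r ⟧) ℕ.≤? 2)
      (residue x) (nz ∘ ∣-residue x (divides (+ 1) refl)))

  -- `half` is half the Lee weight on the even letters; odd letters receive multiplicity 0 from
  -- `even`.
  even half : ℤ₄ → ℕ
  even 0F = 1
  even 1F = 0
  even 2F = 1
  even 3F = 0
  half 0F = 0
  half 1F = 0
  half 2F = 1
  half 3F = 0

  ±≋ : ℤ → ℤ₄ → ℤ₄ → Set
  ±≋ m t c = (+ toℕ c ≋ + toℕ t [ m ]) ⊎ (+ toℕ c ≋ - + toℕ t [ m ])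

  ±≋? : ∀ m t c → Dec (±≋ m t c)
  ±≋? m t c = (+ toℕ c ≋? + toℕ t [ m ]) ⊎-dec (+ toℕ c ≋? - + toℕ t [ m ])

  ±≋2⇒even : ∀ t c → ±≋ (+ 2) t c → even c ≡ even t
  ±≋2⇒even = from-yes (all? λ t → all? λ c → ±≋? (+ 2) t c →-dec even c ℕ.≟ even t)

  ±≋4⇒lee : ∀ t c → ±≋ (+ 4) t c → lee c ≡ lee t
  ±≋4⇒lee = from-yes (all? λ t → all? λ c → ±≋? (+ 4) t c →-dec lee c ℕ.≟ lee t)

  even≡0⇒1≤lee : ∀ c → even c ≡ 0 → 1 ℕ.≤ lee c
  even≡0⇒1≤lee 1F _ = ℕ.s≤s ℕ.z≤n
  even≡0⇒1≤lee 3F _ = ℕ.s≤s ℕ.z≤n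

  length≤leeWeight : ∀ {n} (w : Word n) → (∀ i → 1 ℕ.≤ lee (lookup w i)) → n ℕ.≤ leeWeight w
  length≤leeWeight []      h = ℕ.z≤n
  length≤leeWeight (c ∷ w) h = ℕ.+-mono-≤ (h zero) (length≤leeWeight w (h ∘ suc))

  lee≡0⇒zeroWord : ∀ {n} (w : Word n) → (∀ i → lee (lookup w i) ≡ 0) → w ≡ zeroWord n
  lee≡0⇒zeroWord []       h = refl
  lee≡0⇒zeroWord (0F ∷ w) h = cong (0F ∷_) (lee≡0⇒zeroWord w (h ∘ suc))
  lee≡0⇒zeroWord (1F ∷ w) h = contradiction (h zero) λ ()
  lee≡0⇒zeroWord (2F ∷ w) h = contradiction (h zero) λ ()
  lee≡0⇒zeroWord (3F ∷ w) h = contradiction (h zero) λ ()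

  ∏ᵛ-≡1 : ∀ {A : Set} {n} (g : A → ℕ) (v : Vec A n) → (∀ i → g (lookup v i) ≡ 1) → ∏ᵛ g v ≡ 1
  ∏ᵛ-≡1 g []      h = refl
  ∏ᵛ-≡1 g (x ∷ v) h = cong₂ ℕ._*_ (h zero) (∏ᵛ-≡1 g v (h ∘ suc))

  half+half≤lee : ∀ {n} (w : Word n) → weight half w ℕ.+ weight half w ℕ.≤ leeWeight w
  half+half≤lee []      = ℕ.z≤n
  half+half≤lee (c ∷ w) = ℕ.≤-trans (ℕ.≤-reflexive (lemma (half c) (weight half w))) (ℕ.+-mono-≤ (go c) (half+half≤lee w))
    where
    lemma : ∀ a b → (a ℕ.+ b) ℕ.+ (a ℕ.+ b) ≡ (a ℕ.+ a) ℕ.+ (b ℕ.+ b)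
    lemma = solve-∀ℕ
    go : ∀ c → half c ℕ.+ half c ℕ.≤ lee c
    go 0F = ℕ.z≤n
    go 1F = ℕ.z≤n
    go 2F = ℕ.≤-refl
    go 3F = ℕ.z≤n

  -- Averaging over the random matrices.

  module Averaging {p : ℕ} (S : Similarity p) where

    open Construction S public

    code : Columns p → Code (p ℕ.+ p)
    code R = GraphCode (matrix R)

    translate? : ∀ (t : ℤ₄) R w → Dec (∀ i → Y w i ≋ (matrix R ⊛ X w) i + + toℕ t [ + 4 ])
    translate? t R w = all? λ i → Y w i ≋? (matrix R ⊛ X w) i + + toℕ t [ + 4 ]

    code? : ∀ R w → Dec (code R w)
    code? R w = (+ 4 ∣? sum (X w)) ×-dec any? λ t → translate? t R w

    columns : List (Vec ℤ₄ p)
    columns = vecs (allFin 4) p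

    allColumns : List (Columns p)
    allColumns = vecs columns p

    length-columns : length columns ≡ 4 ℕ.^ p
    length-columns = length-vecs (allFin 4) p

    -- Row i ≠ k of the membership condition is one linear equation for the entry
    -- (i , k) of R, in which no other entry of column k occurs.
    count-line : ∀ {s} w k → 1 ℕ.≤ s → Solutions≤ s (X w k) → ∀ t R →
                 ∑ columns (λ v → ⟦ translate? t (R [ k ]≔ v) w ⟧) ℕ.≤ 4 ℕ.* s ℕ.^ p
    count-line {s} w k 1≤s sol t R = begin
      ∑ columns (λ v → ⟦ translate? t (R [ k ]≔ v) w ⟧)
        ≤⟨ ∑-mono columns (λ v → ⟦⟧-≤ (translate? t (R [ k ]≔ v) w)
             (λ h → ℕ.≤-reflexive (sym (∏-≡1 (λ i → ⟦⟧-true (g? i (lookup v i)) (equation v h i)))))) ⟩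
      ∑ columns (λ v → ∏ (λ i → ⟦ g? i (lookup v i) ⟧))
        ≡⟨ ∑-∏ (allFin 4) p (λ i a → ⟦ g? i a ⟧) ⟩
      ∏ (λ i → ∑ (allFin 4) (λ a → ⟦ g? i a ⟧))
        ≤⟨ ∏-≤-except k 1≤s (∑-≤-const (allFin 4) (λ a → ⟦⟧≤1 (g? k a)))
             (λ i i≢k → ℕ.≤-trans (∑-mono (allFin 4) (λ a → ⟦⟧-mono (g? i a) (+ 4 ∣? c i - + toℕ a * X w k)
                (fromInj₂ (λ i≡k → contradiction i≡k i≢k)))) (sol (c i))) ⟩
      4 ℕ.* s ℕ.^ p ∎
      where
      open ℕ.≤-Reasoning
      c : Fin p → ℤ
      c i = Y w i - ((matrix R ⊛ X w) i - entry R i k * X w k + + toℕ t)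
      -- Row `k` involves other entries of the column, so its condition is dropped, at the cost of a
      -- factor 4. The rest is a product condition, entry by entry.
      g? : ∀ i a → Dec (i ≡ k ⊎ + 4 ∣ c i - + toℕ a * X w k)
      g? i a = (i Fin.≟ k) ⊎-dec (+ 4 ∣? c i - + toℕ a * X w k)
      rearrange : ∀ y m v e x t → y - (m + (v - e) * x + t) ≡ y - (m - e * x + t) - v * x
      rearrange = solve-∀
      equation : ∀ v → (∀ i → Y w i ≋ (matrix (R [ k ]≔ v) ⊛ X w) i + + toℕ t [ + 4 ]) →
                 ∀ i → i ≡ k ⊎ + 4 ∣ c i - coord v i * X w k
      equation v h i with i Fin.≟ k
      ... | yes i≡k = inj₁ i≡k
      ... | no i≢k  = inj₂ (subst (+ 4 ∣_)
        (trans (cong (λ z → Y w i - (z + + toℕ t)) (matrix-update-⊛ R k v i≢k (X w)))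
          (rearrange (Y w i) ((matrix R ⊛ X w) i) (coord v i) (entry R i k) (X w k) (+ toℕ t)))
        (m∣a-b (h i)))

    -- A union over the shifts `t`, then an average over lines of matrices differing in column `k`.
    -- The 16 is four shifts times four values for the unconstrained entry (k, k).
    count-code : ∀ {s} w k → 1 ℕ.≤ s → Solutions≤ s (X w k) →
                 4 ℕ.^ p ℕ.* ∑ allColumns (λ R → ⟦ code? R w ⟧) ℕ.≤ length allColumns ℕ.* (16 ℕ.* s ℕ.^ p)
    count-code {s} w k 1≤s sol = begin
      4 ℕ.^ p ℕ.* ∑ allColumns (λ R → ⟦ code? R w ⟧)
        ≤⟨ ℕ.*-monoʳ-≤ (4 ℕ.^ p) (∑-mono allColumns (λ R → ⟦⟧-≤ (code? R w) (λ (_ , t , h) →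
             ℕ.≤-trans (ℕ.≤-reflexive (sym (⟦⟧-true (translate? t R w) h))) (∈⇒≤∑ (λ t → ⟦ translate? t R w ⟧) (∈-allFin t))))) ⟩
      4 ℕ.^ p ℕ.* ∑ allColumns (λ R → ∑ (allFin 4) (λ t → ⟦ translate? t R w ⟧))
        ≡⟨ cong₂ ℕ._*_ (sym length-columns) (Sums.∑-comm allColumns (allFin 4) (λ R t → ⟦ translate? t R w ⟧)) ⟩
      length columns ℕ.* ∑ (allFin 4) (λ t → ∑ allColumns (λ R → ⟦ translate? t R w ⟧))
        ≡⟨ ∑-distribˡ-* (allFin 4) (length columns) (λ t → ∑ allColumns (λ R → ⟦ translate? t R w ⟧)) ⟨
      ∑ (allFin 4) (λ t → length columns ℕ.* ∑ allColumns (λ R → ⟦ translate? t R w ⟧))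
        ≤⟨ ∑-≤-const (allFin 4) (λ t → ∑-vecs-line columns k (λ R → ⟦ translate? t R w ⟧) (4 ℕ.* s ℕ.^ p) (count-line w k 1≤s sol t)) ⟩
      4 ℕ.* (length columns ℕ.^ p ℕ.* (4 ℕ.* s ℕ.^ p))
        ≡⟨ cong (λ l → 4 ℕ.* (l ℕ.* (4 ℕ.* s ℕ.^ p))) (sym (length-vecs columns p)) ⟩
      4 ℕ.* (length allColumns ℕ.* (4 ℕ.* s ℕ.^ p))
        ≡⟨ lemma (length allColumns) (s ℕ.^ p) ⟩
      length allColumns ℕ.* (16 ℕ.* s ℕ.^ p) ∎
      where
      open ℕ.≤-Reasoning
      lemma : ∀ a b → 4 ℕ.* (a ℕ.* (4 ℕ.* b)) ≡ a ℕ.* (16 ℕ.* b)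
      lemma = solve-∀ℕ

    -- With x ≡ 0 the code equation leaves y ≡ t·1. Then a = x + y ≡ t·1, while 7b = Hᵀy has entries
    -- 5t or -t, which makes those of b equal to ±t because `m` divides 4.
    entries : ∀ {m K w} → m ∣ + 4 → (cw : GraphCode K w) → (∀ i → m ∣ X w i) →
              ∀ j → ±≋ m (proj₁ (proj₂ cw)) (lookup w j)
    entries {m} {K} {w} m∣4 (_ , t , h) m∣X j = go (splitAt p j) refl
      where
      ≋0 : ∀ {a} → m ∣ a → a ≋ 0ℤ [ m ]
      ≋0 {a} m∣a = mod (subst (m ∣_) (sym (+-identityʳ a)) m∣a)
      4≋0 : ∀ a → a * + 4 ≋ 0ℤ [ m ]
      4≋0 a = ≋0 (∣n⇒∣m*n a m∣4)
      K⊛X≋0 : ∀ i → (K ⊛ X w) i ≋ 0ℤ [ m ]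
      K⊛X≋0 i = ≋-trans (∙-≋ (K i) (≋0 ∘ m∣X)) (≋-reflexive (trans (∙-const (K i) 0ℤ) (*-zeroˡ (sum (K i)))))
      Y≋t : ∀ i → Y w i ≋ + toℕ t [ m ]
      Y≋t i = ≋-trans (mod (∣-trans m∣4 (m∣a-b (h i))))
        (≋-trans (≋-+ (K⊛X≋0 i) (≋-reflexive refl)) (≋-reflexive (+-identityˡ (+ toℕ t))))
      left≋t : ∀ i → left w i ≋ + toℕ t [ m ]
      left≋t i = ≋-trans (≋-reflexive (lemma (left w i) (Y w i)))
        (≋-trans (≋-+ (≋0 (m∣X i)) (Y≋t i)) (≋-reflexive (+-identityˡ (+ toℕ t))))
        where lemma : ∀ a y → a ≡ a - y + y
              lemma = solve-∀
      right≋±t : ∀ i → (Uᵀ (Y w) i ≋ + 5 * + toℕ t [ m ]) ⊎ (Uᵀ (Y w) i ≋ - + toℕ t [ m ]) →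
                 ±≋ m t (lookup w (p ↑ʳ i))
      right≋±t i q = Sum.swap (Sum.map minus plus q)
        where
        right≋ : ∀ {c} → Uᵀ (Y w) i ≋ c [ m ] → right w i ≋ 0ℤ - c [ m ]
        right≋ {c} q = ≋-trans (≋-reflexive (lemma (right w i)))
          (≋-- (4≋0 (+ 2 * right w i)) (subst (_≋ c [ m ]) (Uᵀ-U (right w) i) q))
          where lemma : ∀ b → b ≡ + 2 * b * + 4 - + 7 * b
                lemma = solve-∀
        minus : Uᵀ (Y w) i ≋ + 5 * + toℕ t [ m ] → right w i ≋ - + toℕ t [ m ]
        minus q = ≋-trans (right≋ q) (≋-trans (≋-reflexive (lemma (+ toℕ t)))
          (≋-trans (≋-- (≋-reflexive {a = - + toℕ t} refl) (4≋0 (+ toℕ t))) (≋-reflexive (+-identityʳ (- + toℕ t)))))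
          where lemma : ∀ t → 0ℤ - + 5 * t ≡ - t - t * + 4
                lemma = solve-∀
        plus : Uᵀ (Y w) i ≋ - + toℕ t [ m ] → right w i ≋ + toℕ t [ m ]
        plus q = ≋-trans (right≋ q) (≋-reflexive (lemma (+ toℕ t)))
          where lemma : ∀ t → 0ℤ - - t ≡ t
                lemma = solve-∀
      go : ∀ s → splitAt p j ≡ s → ±≋ m t (lookup w j)
      go (inj₁ i) eq = subst (λ j → ±≋ m t (lookup w j)) (Fin.splitAt⁻¹-↑ˡ eq) (inj₁ (left≋t i))
      go (inj₂ i) eq = subst (λ j → ±≋ m t (lookup w j)) (Fin.splitAt⁻¹-↑ʳ eq) (right≋±t i (Uᵀ-const (+ toℕ t) Y≋t i))

    module _ (L : ℕ) (L<n : L ℕ.< p ℕ.+ p) where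

      Bad : Columns p → Word (p ℕ.+ p) → Set
      Bad R w = code R w × ¬ w ≡ zeroWord (p ℕ.+ p) × leeWeight w ℕ.≤ L

      bad? : ∀ R w → Dec (Bad R w)
      bad? R w = code? R w ×-dec ¬? (≡-dec Fin._≟_ w (zeroWord (p ℕ.+ p))) ×-dec (leeWeight w ℕ.≤? L)

      badCount : Word (p ℕ.+ p) → ℕ
      badCount w = ∑ allColumns (λ R → ⟦ bad? R w ⟧)

      -- All entries share the parity of `t`; if they were odd, the Lee weight would be at least 2p
      -- > L.
      bad-even : ∀ {R w} → (∀ i → + 2 ∣ X w i) → Bad R w → ∀ j → even (lookup w j) ≡ 1
      bad-even {R} {w} 2∣X (cw@(_ , t , _) , _ , low) = go (even t) refl
        where
        parity : ∀ j → even (lookup w j) ≡ even t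
        parity j = ±≋2⇒even t (lookup w j) (entries {K = matrix R} {w} (divides (+ 2) refl) cw 2∣X j)
        go : ∀ e → e ≡ even t → ∀ j → even (lookup w j) ≡ 1
        go 0 eq = contradiction (ℕ.≤-trans (length≤leeWeight w (λ j → even≡0⇒1≤lee (lookup w j) (trans (parity j) (sym eq)))) low) (ℕ.<⇒≱ L<n)
        go (suc e) eq j = trans (parity j) (one t (λ t≡0 → contradiction (trans eq t≡0) λ ()))
          where
          one : ∀ t → even t ≢ 0 → even t ≡ 1
          one 0F _ = refl
          one 1F h = contradiction refl h
          one 2F _ = refl
          one 3F h = contradiction refl h

      -- All entries are ±t: either the word is zero, or its Lee weight is at least 2p > L.
      bad-nonzero : ∀ {R w} → (∀ i → + 4 ∣ X w i) → ¬ Bad R w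
      bad-nonzero {R} {w} 4∣X (cw@(_ , t , _) , w≢0 , low) = go (lee t ℕ.≟ 0)
        where
        same : ∀ j → lee (lookup w j) ≡ lee t
        same j = ±≋4⇒lee t (lookup w j) (entries {K = matrix R} {w} (divides (+ 1) refl) cw 4∣X j)
        go : ¬ Dec (lee t ≡ 0)
        go (yes t≡0) = w≢0 (lee≡0⇒zeroWord w (λ j → trans (same j) t≡0))
        go (no t≢0)  = ℕ.<⇒≱ L<n (ℕ.≤-trans (length≤leeWeight w (λ j → subst (1 ℕ.≤_) (sym (same j)) (ℕ.n≢0⇒n>0 t≢0))) low)

      noBad : ∀ {w m} → (∀ R → ¬ Bad R w) → 4 ℕ.^ p ℕ.* badCount w ℕ.≤ m
      noBad {w} ¬bad = ℕ.≤-trans (ℕ.≤-reflexive (trans (cong (4 ℕ.^ p ℕ.*_) (trans (∑-cong allColumns (λ R → ⟦⟧-false (bad? R w) (¬bad R)))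
        (trans (∑-const allColumns 0) (ℕ.*-zeroʳ (length allColumns))))) (ℕ.*-zeroʳ (4 ℕ.^ p)))) ℕ.z≤n

      badCount-≤ : ∀ {s} w k → 1 ℕ.≤ s → Solutions≤ s (X w k) →
                   4 ℕ.^ p ℕ.* badCount w ℕ.≤ length allColumns ℕ.* (16 ℕ.* s ℕ.^ p)
      badCount-≤ w k 1≤s sol = ℕ.≤-trans (ℕ.*-monoʳ-≤ (4 ℕ.^ p)
        (∑-mono allColumns (λ R → ⟦⟧-mono (bad? R w) (code? R w) proj₁))) (count-code w k 1≤s sol)

      -- Indicators written as summands of `ball`, including the constant product in `low`, so that
      -- their sums over all words are balls by definition.
      low lowEven : Word (p ℕ.+ p) → ℕ
      low w = ∏ᵛ (λ _ → 1) w ℕ.* ⟦ weight lee w ℕ.≤? L ⟧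
      lowEven w = ∏ᵛ even w ℕ.* ⟦ weight half w ℕ.≤? ℕ.⌊ L /2⌋ ⟧

      low≡1 : ∀ w → leeWeight w ℕ.≤ L → low w ≡ 1
      low≡1 w h = cong₂ ℕ._*_ (∏ᵛ-≡1 (λ _ → 1) w (λ _ → refl)) (⟦⟧-true (weight lee w ℕ.≤? L) h)

      lowEven≡1 : ∀ w → leeWeight w ℕ.≤ L → (∀ j → even (lookup w j) ≡ 1) → lowEven w ≡ 1
      lowEven≡1 w h ev = cong₂ ℕ._*_ (∏ᵛ-≡1 even w ev) (⟦⟧-true (weight half w ℕ.≤? ℕ.⌊ L /2⌋)
        (ℕ.≤-trans (ℕ.≤-reflexive (ℕ.n≡⌊n+n/2⌋ (weight half w))) (ℕ.⌊n/2⌋-mono (ℕ.≤-trans (half+half≤lee w) h))))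

      -- An odd entry of x allows one solution per row. If x is even but nonzero modulo 4, two
      -- solutions per row give 2ᵖ, charged only to even words. If x ≡ 0, the word is never bad.
      badCount-bound : ∀ w → 4 ℕ.^ p ℕ.* badCount w ℕ.≤ length allColumns ℕ.* (16 ℕ.* low w ℕ.+ 16 ℕ.* (2 ℕ.^ p ℕ.* lowEven w))
      badCount-bound w = go (leeWeight w ℕ.≤? L) (any? (λ k → ¬? (+ 2 ∣? X w k))) (any? (λ k → ¬? (+ 4 ∣? X w k)))
          (all? (λ j → even (lookup w j) ℕ.≟ 1))
        where
        go : Dec (leeWeight w ℕ.≤ L) → Dec (Σ (Fin p) λ k → ¬ + 2 ∣ X w k) → Dec (Σ (Fin p) λ k → ¬ + 4 ∣ X w k) →
             Dec (∀ j → even (lookup w j) ≡ 1) →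
             4 ℕ.^ p ℕ.* badCount w ℕ.≤ length allColumns ℕ.* (16 ℕ.* low w ℕ.+ 16 ℕ.* (2 ℕ.^ p ℕ.* lowEven w))
        go (no ¬lw) _ _ _ = noBad λ R (_ , _ , lw) → ¬lw lw
        go (yes lw) (yes (k , odd)) _ _ = ℕ.≤-trans (badCount-≤ w k ℕ.≤-refl (odd⇒solutions≤1 (X w k) odd))
          (ℕ.*-monoʳ-≤ (length allColumns) (ℕ.≤-trans
            (ℕ.≤-reflexive (cong (16 ℕ.*_) (trans (ℕ.^-zeroˡ p) (sym (low≡1 w lw))))) (ℕ.m≤m+n (16 ℕ.* low w) _)))
        go (yes lw) (no ¬odd) (yes (k , nz)) (yes ev) = ℕ.≤-trans (badCount-≤ w k (ℕ.s≤s ℕ.z≤n) (nonzero⇒solutions≤2 (X w k) nz))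
          (ℕ.*-monoʳ-≤ (length allColumns) (ℕ.≤-trans (ℕ.≤-reflexive (cong (16 ℕ.*_)
            (trans (sym (ℕ.*-identityʳ (2 ℕ.^ p))) (cong (2 ℕ.^ p ℕ.*_) (sym (lowEven≡1 w lw ev)))))) (ℕ.m≤n+m _ (16 ℕ.* low w))))
        go (yes lw) (no ¬odd) (yes _) (no ¬ev) = noBad λ R bad →
          ¬ev (bad-even {R} (λ i → decidable-stable (+ 2 ∣? X w i) (λ odd → ¬odd (i , odd))) bad)
        go (yes lw) (no ¬odd) (no ¬nz) _ = noBad λ R →
          bad-nonzero {R} (λ i → decidable-stable (+ 4 ∣? X w i) (λ nz → ¬nz (i , nz)))

      -- The hypothesis puts the expected number of bad words below 1.
      goodColumns : 16 ℕ.* ∑ (vecs (allFin 4) (p ℕ.+ p)) low ℕ.+ 16 ℕ.* (2 ℕ.^ p ℕ.* ∑ (vecs (allFin 4) (p ℕ.+ p)) lowEven) ℕ.< 4 ℕ.^ p →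
                    Σ (Columns p) λ R → ∀ w → ¬ Bad R w
      goodColumns lt =
        let R , R∈ , eq = ∑<length⇒∃≡0 allColumns (λ R → ∑ words (λ w → ⟦ bad? R w ⟧)) few
        in R , λ w → ⟦⟧≡0⇒¬ (bad? R w) (∑≡0⇒≡0 {f = λ w → ⟦ bad? R w ⟧} eq (∈-vecs ∈-allFin w))
        where
        open ℕ.≤-Reasoning
        words = vecs (allFin 4) (p ℕ.+ p)
        nonempty : ℕ.NonZero (length allColumns)
        nonempty = subst ℕ.NonZero (sym (trans (length-vecs columns p) (cong (ℕ._^ p) length-columns)))
          (ℕ.m^n≢0 (4 ℕ.^ p) p {{ℕ.m^n≢0 4 p}})
        few : ∑ allColumns (λ R → ∑ words (λ w → ⟦ bad? R w ⟧)) ℕ.< length allColumns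
        few = ℕ.*-cancelˡ-< (4 ℕ.^ p) _ _ (begin-strict
          4 ℕ.^ p ℕ.* ∑ allColumns (λ R → ∑ words (λ w → ⟦ bad? R w ⟧))
            ≡⟨ cong (4 ℕ.^ p ℕ.*_) (Sums.∑-comm allColumns words (λ R w → ⟦ bad? R w ⟧)) ⟩
          4 ℕ.^ p ℕ.* ∑ words badCount
            ≡⟨ ∑-distribˡ-* words (4 ℕ.^ p) badCount ⟨
          ∑ words (λ w → 4 ℕ.^ p ℕ.* badCount w)
            ≤⟨ ∑-mono words badCount-bound ⟩
          ∑ words (λ w → length allColumns ℕ.* (16 ℕ.* low w ℕ.+ 16 ℕ.* (2 ℕ.^ p ℕ.* lowEven w)))
            ≡⟨ trans (∑-distribˡ-* words (length allColumns) _) (cong (length allColumns ℕ.*_)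
                 (trans (Sums.∑-distrib-+ words (λ w → 16 ℕ.* low w) (λ w → 16 ℕ.* (2 ℕ.^ p ℕ.* lowEven w)))
                   (cong₂ ℕ._+_ (∑-distribˡ-* words 16 low)
                     (trans (∑-distribˡ-* words 16 (λ w → 2 ℕ.^ p ℕ.* lowEven w)) (cong (16 ℕ.*_) (∑-distribˡ-* words (2 ℕ.^ p) lowEven)))))) ⟩
          length allColumns ℕ.* (16 ℕ.* ∑ words low ℕ.+ 16 ℕ.* (2 ℕ.^ p ℕ.* ∑ words lowEven))
            <⟨ ℕ.*-monoʳ-< (length allColumns) {{nonempty}} lt ⟩
          length allColumns ℕ.* 4 ℕ.^ p
            ≡⟨ ℕ.*-comm (length allColumns) (4 ℕ.^ p) ⟩
          4 ℕ.^ p ℕ.* length allColumns ∎)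

    -- Minimum weights and the best matrix.

    NonzeroCodeword : Columns p → Word (p ℕ.+ p) → Set
    NonzeroCodeword R w = code R w × ¬ w ≡ zeroWord (p ℕ.+ p)

    nonzeroCodeword? : ∀ R w → Dec (NonzeroCodeword R w)
    nonzeroCodeword? R w = code? R w ×-dec ¬? (≡-dec Fin._≟_ w (zeroWord (p ℕ.+ p)))

    -- With x = 0 and y = 1 it lies in every code, through t = 1, and its entries are ±1. It
    -- provides the default value for the minimum.
    witness : Word (p ℕ.+ p)
    witness = encode (λ _ → 0ℤ) (λ _ → 1ℤ)

    witness-codeword : ∀ R → NonzeroCodeword R witness
    witness-codeword R = cw , λ eq → contradiction (trans (sym (lee≡1 (o ↑ˡ p)))
        (cong lee (trans (cong (λ w → lookup w (o ↑ˡ p)) eq) (lookup-replicate (o ↑ˡ p) 0₄)))) λ ()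
      where
      cw : code R witness
      cw = encode∈GraphCode (matrix R) (λ _ → 0ℤ) (λ _ → 1ℤ) 1F (sum-replicate-zero p)
        (λ i → cong (_+ 1ℤ) (sym (trans (∙-const (matrix R i) 0ℤ) (*-zeroˡ (sum (matrix R i))))))
      lee≡1 : ∀ j → lee (lookup witness j) ≡ 1
      lee≡1 j = ±≋4⇒lee 1F (lookup witness j) (entries {K = matrix R} {witness} (divides (+ 1) refl) cw
        (λ i → ≋⇒∣ (X-encode (λ _ → 0ℤ) (λ _ → 1ℤ) i) (divides 0ℤ refl)) j)

    words : List (Word (p ℕ.+ p))
    words = vecs (allFin 4) (p ℕ.+ p)

    minWord : Columns p → Word (p ℕ.+ p)
    minWord R = argmin leeWeight witness (filter (nonzeroCodeword? R) words)

    minLee : Columns p → ℕ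
    minLee R = leeWeight (minWord R)

    minWord-codeword : ∀ R → NonzeroCodeword R (minWord R)
    minWord-codeword R = argmin-all leeWeight {P = NonzeroCodeword R} (witness-codeword R) (all-filter (nonzeroCodeword? R) words)

    minLee-isMinLee : ∀ R → IsMinLee (code R) (minLee R)
    minLee-isMinLee R = (minWord R , proj₁ (minWord-codeword R) , proj₂ (minWord-codeword R) , refl)
      , λ w cw w≢0 → All.lookup (f[argmin]≤f[xs] {f = leeWeight} witness (filter (nonzeroCodeword? R) words))
          (∈-filter⁺ (nonzeroCodeword? R) (∈-vecs ∈-allFin w) (cw , w≢0))

    -- Chosen without reference to a radius, so that one code serves every `L`; the zero matrix is
    -- the default value of `argmax`.
    best : Columns p
    best = argmax minLee (replicate p (replicate p 0F)) allColumns

    best-typeII : IsTypeII (code best)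
    best-typeII = GraphCode-typeII (matrix best) (matrix-skew best)

    <minLee-best : ∀ L (L<n : L ℕ.< p ℕ.+ p) →
      16 ℕ.* ∑ words (low L L<n) ℕ.+ 16 ℕ.* (2 ℕ.^ p ℕ.* ∑ words (lowEven L L<n)) ℕ.< 4 ℕ.^ p → L ℕ.< minLee best
    <minLee-best L L<n lt =
      let R , good = goodColumns L L<n lt
          cw , w≢0 = minWord-codeword R
      in ℕ.≤-trans (ℕ.≰⇒> (λ low → good (minWord R) (cw , w≢0 , low)))
           (All.lookup (f[xs]≤f[argmax] {f = minLee} (replicate p (replicate p 0F)) allColumns) (∈-vecs (∈-vecs ∈-allFin) R))

-- Arithmetic of the estimates.

open Sums
open GraphCodes using (Similarity; H-similarity)
open RandomCodes using (even; half; module Averaging)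
open import Data.Nat
open import Data.Nat.Properties
open import Data.Nat.DivMod using (_/_; _%_; m/n*n≤m; m≡m%n+[m/n]*n; m%n<n)

-- Bernoulli's inequality 1 + n/P ≤ (1 + 1/P)ⁿ with denominators cleared.
bernoulli : ∀ P n → (P + n) * P ^ n ≤ P * (P + 1) ^ n
bernoulli P zero    = ≤-reflexive (cong (_* 1) (+-identityʳ P))
bernoulli P (suc n) = begin
  (P + suc n) * (P * P ^ n)               ≤⟨ m≤m+n _ (n * P ^ n) ⟩
  (P + suc n) * (P * P ^ n) + n * P ^ n   ≡⟨ lemma P n (P ^ n) ⟩
  (P + n) * P ^ n * (P + 1)               ≤⟨ *-monoˡ-≤ (P + 1) (bernoulli P n) ⟩
  P * (P + 1) ^ n * (P + 1)               ≡⟨ lemma′ P ((P + 1) ^ n) ⟩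
  P * ((P + 1) * (P + 1) ^ n)             ∎
  where
  open ≤-Reasoning
  lemma : ∀ P n x → (P + (1 + n)) * (P * x) + n * x ≡ (P + n) * x * (P + 1)
  lemma = solve-∀ℕ
  lemma′ : ∀ P x → P * x * (P + 1) ≡ P * ((P + 1) * x)
  lemma′ = solve-∀ℕ

-- (Q/P)ⁿ ≥ (1 + 1/P)ⁿ ≥ 1 + n/P ≥ 1 + D.
^-dominates : ∀ P {Q} D n .{{_ : NonZero P}} → P < Q → D * P ≤ n → D * P ^ n < Q ^ n
^-dominates P {Q} D n P<Q DP≤n = begin-strict
  D * P ^ n         <⟨ *-monoˡ-< (P ^ n) {{m^n≢0 P n}} (n<1+n D) ⟩
  (1 + D) * P ^ n   ≤⟨ *-cancelˡ-≤ P bound ⟩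
  Q ^ n             ∎
  where
  open ≤-Reasoning
  bound : P * ((1 + D) * P ^ n) ≤ P * Q ^ n
  bound = begin
    P * ((1 + D) * P ^ n)   ≡⟨ lemma P D (P ^ n) ⟩
    (P + D * P) * P ^ n     ≤⟨ *-monoˡ-≤ (P ^ n) (+-monoʳ-≤ P DP≤n) ⟩
    (P + n) * P ^ n         ≤⟨ bernoulli P n ⟩
    P * (P + 1) ^ n         ≤⟨ *-monoʳ-≤ P (^-monoˡ-≤ n (≤-trans (≤-reflexive (+-comm P 1)) P<Q)) ⟩
    P * Q ^ n               ∎
    where lemma : ∀ P D x → P * ((1 + D) * x) ≡ (P + D * P) * x
          lemma = solve-∀ℕ

^-cancelʳ-< : ∀ {m n} o → m ^ o < n ^ o → m < n
^-cancelʳ-< o lt = ≰⇒> (λ n≤m → <⇒≱ lt (^-monoˡ-≤ o n≤m))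

^-swap : ∀ m n o → (m ^ n) ^ o ≡ (m ^ o) ^ n
^-swap m n o = trans (^-*-assoc m n o) (trans (cong (m ^_) (*-comm n o)) (sym (^-*-assoc m o n)))

^-double : ∀ m n → m ^ (2 * n) ≡ m ^ n * m ^ n
^-double m n = trans (cong (λ k → m ^ (n + k)) (+-identityʳ n)) (^-distribˡ-+-* m n n)

-- Each summand takes at most half of y². It is applied with y = 2ᵖ, the balls of all and of even
-- words being x and z.
16x+16yz<yy : ∀ x y z → 32 * x < y * y → 32 * z < y → 16 * x + 16 * (y * z) < y * y
16x+16yz<yy x y z 32x<yy 32z<y = *-cancelʳ-< 2 (16 * x + 16 * (y * z)) (y * y) (begin-strict
  (16 * x + 16 * (y * z)) * 2   ≡⟨ lemma x y z ⟩
  32 * x + y * (32 * z)         <⟨ +-mono-<-≤ 32x<yy (*-monoʳ-≤ y (<⇒≤ 32z<y)) ⟩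
  y * y + y * y                 ≡⟨ lemma′ (y * y) ⟩
  y * y * 2                     ∎)
  where
  open ≤-Reasoning
  lemma : ∀ x y z → (16 * x + 16 * (y * z)) * 2 ≡ 32 * x + y * (32 * z)
  lemma = solve-∀ℕ
  lemma′ : ∀ x → x + x ≡ x * 2
  lemma′ = solve-∀ℕ

-- The union bound at relative radius a/b with H(a/b) < 1/2.

module Estimate (a c : ℕ) (a<c : a < c)
  (below : (a + c) ^ (2 * (a + c)) < 2 ^ (a + c) * (a ^ (2 * a) * c ^ (2 * c)))
  (p : ℕ) (large : 32 ^ (2 * (a + c)) * (a + c) ^ (2 * (a + c)) ≤ p + p)
  (L : ℕ) (bL≤ : (a + c) * L ≤ a * ((p + p) * 2)) where

  private
    open ≤-Reasoning
    b = a + c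
    n = p + p
    -- In terms of entropy κ = bᵇ · 2^(-bH(a/b)), so `below` says b²ᵇ < 2ᵇκ².
    κ = a ^ a * c ^ c
    D = 32 ^ (2 * b)
    P = b ^ (2 * b)

    instance
      b≢0 : NonZero b
      b≢0 = >-nonZero (≤-trans (s≤s z≤n) (≤-trans a<c (m≤n+m c a)))

    lee-complement : ∀ x → lee x + (2 ∸ lee x) ≡ 2
    lee-complement 0F = refl
    lee-complement 1F = refl
    lee-complement 2F = refl
    lee-complement 3F = refl

    half-complement : ∀ x → half x + (1 ∸ half x) ≡ 1
    half-complement 0F = refl
    half-complement 1F = refl
    half-complement 2F = refl
    half-complement 3F = refl

    -- The left side is the form to which the sum in `Ball` evaluates: the letters 0, 1, 2, 3
    -- contribute c², ac, a², ac.
    full-generating : ∀ a c → 1 * (1 * (c * (c * 1))) + (1 * (a * 1 * (c * 1)) + (1 * (a * (a * 1) * 1) + (1 * (a * 1 * (c * 1)) + 0))) ≡ (a + c) * (a + c)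
    full-generating = solve-∀ℕ

    even-generating : ∀ a c → 1 * (1 * (c * 1)) + (0 + (1 * (a * 1 * 1) + (0 + 0))) ≡ a + c
    even-generating = solve-∀ℕ

    module Full = Ball (allFin 4) (λ _ → 1) lee (λ x → 2 ∸ lee x) 2 lee-complement a c (b * b) (full-generating a c)

    module Even = Ball (allFin 4) even half (λ x → 1 ∸ half x) 1 half-complement a c b (even-generating a c)

    -- The n-th power of `below`; since n ≥ D·P there is a factor `D` to spare, which absorbs the
    -- constant 32 in both ball estimates.
    gap : D * P ^ n < (2 ^ n) ^ b * (κ ^ n * κ ^ n)
    gap = begin-strict
      D * P ^ n                                        <⟨ ^-dominates P D n {{m^n≢0 b (2 * b)}} below large ⟩
      (2 ^ b * (a ^ (2 * a) * c ^ (2 * c))) ^ n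
        ≡⟨ cong (λ x → (2 ^ b * x) ^ n) (trans (cong₂ _*_ (^-double a a) (^-double c c)) (lemma (a ^ a) (c ^ c))) ⟩
      (2 ^ b * (κ * κ)) ^ n                            ≡⟨ ^-distribʳ-* (2 ^ b) (κ * κ) n ⟩
      (2 ^ b) ^ n * (κ * κ) ^ n                        ≡⟨ cong₂ _*_ (^-swap 2 b n) (^-distribʳ-* κ κ n) ⟩
      (2 ^ n) ^ b * (κ ^ n * κ ^ n)                    ∎
      where lemma : ∀ x y → x * x * (y * y) ≡ x * y * (x * y)
            lemma = solve-∀ℕ

    full : 32 * Full.ball n L < 2 ^ n
    full = ^-cancelʳ-< b (*-cancelʳ-< (κ ^ n * κ ^ n) _ _ (begin-strict
      (32 * Full.ball n L) ^ b * (κ ^ n * κ ^ n)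
        ≡⟨ cong (_* (κ ^ n * κ ^ n)) (^-distribʳ-* 32 (Full.ball n L) b) ⟩
      32 ^ b * Full.ball n L ^ b * (κ ^ n * κ ^ n)
        ≡⟨ *-assoc (32 ^ b) (Full.ball n L ^ b) (κ ^ n * κ ^ n) ⟩
      32 ^ b * (Full.ball n L ^ b * (κ ^ n * κ ^ n))
        ≡⟨ cong (λ x → 32 ^ b * (Full.ball n L ^ b * x)) (trans (sym (^-double κ n)) (cong (κ ^_) (*-comm 2 n))) ⟩
      32 ^ b * (Full.ball n L ^ b * κ ^ (n * 2))
        ≤⟨ *-mono-≤ (^-monoʳ-≤ 32 (m≤m+n b (b + 0))) (Full.ball-entropy (<⇒≤ a<c) n L bL≤) ⟩
      D * ((b * b) ^ b) ^ n
        ≡⟨ cong (λ x → D * x ^ n) (trans (^-distribʳ-* b b b) (sym (^-double b b))) ⟩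
      D * P ^ n                                           <⟨ gap ⟩
      (2 ^ n) ^ b * (κ ^ n * κ ^ n)                       ∎))

    M = Even.ball n ⌊ L /2⌋

    bL/2≤ : b * ⌊ L /2⌋ ≤ a * (n * 1)
    bL/2≤ = *-cancelʳ-≤ _ _ 2 (begin
      b * ⌊ L /2⌋ * 2               ≡⟨ lemma b ⌊ L /2⌋ ⟩
      b * (⌊ L /2⌋ + ⌊ L /2⌋)       ≤⟨ *-monoʳ-≤ b (+-monoʳ-≤ ⌊ L /2⌋ (⌊n/2⌋≤⌈n/2⌉ L)) ⟩
      b * (⌊ L /2⌋ + ⌈ L /2⌉)       ≡⟨ cong (b *_) (⌊n/2⌋+⌈n/2⌉≡n L) ⟩
      b * L                         ≤⟨ bL≤ ⟩
      a * (n * 2)                   ≡⟨ lemma′ a n ⟩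
      a * (n * 1) * 2               ∎)
      where lemma : ∀ x y → x * y * 2 ≡ x * (y + y)
            lemma = solve-∀ℕ
            lemma′ : ∀ x y → x * (y * 2) ≡ x * (y * 1) * 2
            lemma′ = solve-∀ℕ

    even-entropy : M ^ b * κ ^ n ≤ (b ^ b) ^ n
    even-entropy = subst (λ x → M ^ b * κ ^ x ≤ (b ^ b) ^ n) (*-identityʳ n) (Even.ball-entropy (<⇒≤ a<c) n ⌊ L /2⌋ bL/2≤)

    -- The ball has at most 2^(nH) words, to be compared with 2^(n/2) = 2ᵖ. The power 2b squares
    -- `even-entropy`, so that `gap` applies again.
    evens : 32 * M < 2 ^ p
    evens = ^-cancelʳ-< (2 * b) (*-cancelʳ-< (κ ^ n * κ ^ n) _ _ (begin-strict
      (32 * M) ^ (2 * b) * (κ ^ n * κ ^ n)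
        ≡⟨ cong (_* (κ ^ n * κ ^ n)) (trans (^-distribʳ-* 32 M (2 * b)) (cong (D *_) (^-double M b))) ⟩
      D * (M ^ b * M ^ b) * (κ ^ n * κ ^ n)              ≡⟨ lemma D (M ^ b) (κ ^ n) ⟩
      D * (M ^ b * κ ^ n * (M ^ b * κ ^ n))              ≤⟨ *-monoʳ-≤ D (*-mono-≤ even-entropy even-entropy) ⟩
      D * ((b ^ b) ^ n * (b ^ b) ^ n)
        ≡⟨ cong (D *_) (trans (sym (^-distribʳ-* (b ^ b) (b ^ b) n)) (cong (_^ n) (sym (^-double b b)))) ⟩
      D * P ^ n                                          <⟨ gap ⟩
      (2 ^ n) ^ b * (κ ^ n * κ ^ n)
        ≡⟨ cong (_* (κ ^ n * κ ^ n)) (trans (cong (_^ b) (^-distribˡ-+-* 2 p p)) (trans (^-distribʳ-* (2 ^ p) (2 ^ p) b) (sym (^-double (2 ^ p) b)))) ⟩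
      (2 ^ p) ^ (2 * b) * (κ ^ n * κ ^ n)                ∎))
      where lemma : ∀ d m k → d * (m * m) * (k * k) ≡ d * (m * k * (m * k))
            lemma = solve-∀ℕ

  union-bound : 16 * ∑ (vecs (allFin 4) n) (λ w → ∏ᵛ (λ _ → 1) w * ⟦ weight lee w ≤? L ⟧)
      + 16 * (2 ^ p * ∑ (vecs (allFin 4) n) (λ w → ∏ᵛ even w * ⟦ weight half w ≤? ⌊ L /2⌋ ⟧)) < 4 ^ p
  union-bound = subst (16 * Full.ball n L + 16 * (2 ^ p * M) <_) (sym (^-distribʳ-* 2 2 p))
    (16x+16yz<yy (Full.ball n L) (2 ^ p) M (subst (32 * Full.ball n L <_) (^-distribˡ-+-* 2 p p) full) evens)

-- Codes meeting the bound for every a/b below δ.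

record GilbertVarshamovCode (p : ℕ) : Set₁ where
  field
    code     : Code (p + p)
    minLee   : ℕ
    typeII   : IsTypeII code
    isMinLee : IsMinLee code minLee
    -- The rational a/b is quantified inside the record, so the code depends on `p` alone; only the
    -- length threshold depends on b.
    bound    : ∀ a b → 0 < b → BelowDelta a b → 32 ^ (2 * b) * b ^ (2 * b) ≤ p + p →
               a * (2 * (p + p)) < b * minLee

module _ {p : ℕ} (S : Similarity p) where

  open Averaging S

  minLee-best-bound : ∀ a b → 0 < b → BelowDelta a b → 32 ^ (2 * b) * b ^ (2 * b) ≤ p + p → a * (2 * (p + p)) < b * minLee best
  minLee-best-bound a b 0<b (2a<b , below) n-large = begin-strict
    a * (2 * n)               ≡⟨ m≡m%n+[m/n]*n (a * (2 * n)) b ⟩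
    a * (2 * n) % b + L * b   <⟨ +-monoˡ-< (L * b) (m%n<n (a * (2 * n)) b) ⟩
    suc L * b                 ≤⟨ *-monoˡ-≤ b (<minLee-best L L<n union) ⟩
    minLee best * b           ≡⟨ *-comm (minLee best) b ⟩
    b * minLee best           ∎
    where
    open ≤-Reasoning
    instance
      b≢0 : NonZero b
      b≢0 = >-nonZero 0<b
    n = p + p
    instance
      n≢0 : NonZero n
      n≢0 = >-nonZero (≤-trans (>-nonZero⁻¹ _ {{m*n≢0 (32 ^ (2 * b)) (b ^ (2 * b)) {{m^n≢0 32 (2 * b)}} {{m^n≢0 b (2 * b)}}}}) n-large)
    -- The largest integer radius not above 2na/b; a minimum weight of at least L + 1 then gives the
    -- strict bound.
    L = a * (2 * n) / b
    c = b ∸ a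
    a+a<b : a + a < b
    a+a<b = subst (_< b) (cong (a +_) (+-identityʳ a)) 2a<b
    a+c≡b : a + c ≡ b
    a+c≡b = m+[n∸m]≡n (<⇒≤ (≤-trans (s≤s (m≤m+n a a)) a+a<b))
    a<c : a < c
    a<c = +-cancelˡ-< a a c (subst (a + a <_) (sym a+c≡b) a+a<b)
    Lb≤ : L * b ≤ a * (2 * n)
    Lb≤ = m/n*n≤m (a * (2 * n)) b
    L<n : L < n
    L<n = *-cancelʳ-< b L n (begin-strict
      L * b         ≤⟨ Lb≤ ⟩
      a * (2 * n)   ≡⟨ trans (sym (*-assoc a 2 n)) (cong (_* n) (*-comm a 2)) ⟩
      2 * a * n     <⟨ *-monoˡ-< n 2a<b ⟩
      b * n         ≡⟨ *-comm b n ⟩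
      n * b         ∎)
    union = Estimate.union-bound a c a<c
      (subst (λ x → x ^ (2 * x) < 2 ^ x * (a ^ (2 * a) * c ^ (2 * c))) (sym a+c≡b) below)
      p (subst (λ x → 32 ^ (2 * x) * x ^ (2 * x) ≤ n) (sym a+c≡b) n-large)
      L (≤-trans (≤-reflexive (trans (cong (_* L) a+c≡b) (*-comm b L))) (≤-trans Lb≤ (≤-reflexive (cong (a *_) (*-comm 2 n)))))

  gilbertVarshamovCode : GilbertVarshamovCode p
  gilbertVarshamovCode = record
    { code     = code best
    ; minLee   = minLee best
    ; typeII   = best-typeII
    ; isMinLee = minLee-isMinLee best
    ; bound    = minLee-best-bound
    }

-- The family of lengths 8(i + 1).

theorem40 : Σ (ℕ → ℕ) λ n →
    Σ ((i : ℕ) → Code (n i)) λ C →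
    Σ (ℕ → ℕ) λ l →
    (∀ i → IsTypeII (C i))
    × (∀ i → IsMinLee (C i) (l i))
    × (∀ N → Σ ℕ λ I → ∀ i → I ≤ i → N ≤ n i)
    × (∀ a b → 0 < b → BelowDelta a b →
    Σ ℕ λ I → ∀ i → I ≤ i → a * (2 * n i) < b * l i)
theorem40 =
    (λ i → suc i * 4 + suc i * 4)
  , (λ i → code (family i))
  , (λ i → minLee (family i))
  , (λ i → typeII (family i))
  , (λ i → isMinLee (family i))
  , (λ N → N , λ i → large i)
  -- The i-th length is at least i, so the threshold for the length also serves as the index.
  , λ a b 0<b below → 32 ^ (2 * b) * b ^ (2 * b) , λ i I≤i →
      bound (family i) a b 0<b below (large i I≤i)
  where
  open GilbertVarshamovCode
  family : ∀ i → GilbertVarshamovCode (suc i * 4)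
  family i = gilbertVarshamovCode (H-similarity i)
  open ≤-Reasoning
  large : ∀ {N} i → N ≤ i → N ≤ suc i * 4 + suc i * 4
  large {N} i N≤i = begin
    N                       ≤⟨ N≤i ⟩
    i                       ≤⟨ n≤1+n i ⟩
    suc i                   ≤⟨ m≤m*n (suc i) 4 ⟩
    suc i * 4               ≤⟨ m≤m+n (suc i * 4) (suc i * 4) ⟩
    suc i * 4 + suc i * 4   ∎
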